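{- Given any (multi-head, integer weighted) CHyTN $\Gamma=\langle V,\mathcal{A},L,\mathcal{O},\mathcal{O}V,P\rangle$, there exists a sufficiently small real number $\epsilon\in(0,\infty)$ such that $\Gamma$ is dynamically-consistent if and only if the HyTN $\mathcal{H}_\epsilon(\Gamma)$ is consistent. Moreover, the HyTN $\mathcal{H}_\epsilon(\Gamma)$ has at most $|\Sigma_P|\cdot|V|$ nodes, $O(|\Sigma_P||\mathcal{A}|+|\Sigma_P|^2|V|)$ hyperarcs, and it has size $O(|\Sigma_P|m_{\mathcal{A}}+|\Sigma_P|^2|V||P|)$.
   Context: HyTN. A (multi-head) Hyper Temporal Network (HyTN) is a pair $(V',\mathcal{A}')$ with $V'$ a finite set of nodes and $\mathcal{A}'$ a finite set of hyperarcs $(t,H,w)$ with tail $t\in V'$, nonempty set of heads $H\subseteq V'$ and weights $w:H\to\mathbb{R}$. It is consistent if there is a schedule $\phi:V'\to\mathbb{R}$ with $\phi(t)\ge\min_{v\in H}\{\phi(v)-w(v)\}$ for every $(t,H,w)\in\mathcal{A}'$. Its size is $\sum_{(t,H,w)\in\mathcal{A}'}|H\cup\{t\}|$. Labels. Let $P$ be a finite set of boolean variables. A label is a (possibly empty) conjunction of literals over $P$; $P^*$ is the set of all labels. $\mathrm{Sub}(\ell_1,\ell_2)$ ("$\ell_1$ subsumes $\ell_2$") means $\ell_1\Rightarrow\ell_2$ holds. CHyTN. A (multi-head) Conditional Hyper Temporal Network (CHyTN) is a tuple $\Gamma=\langle V,\mathcal{A},L,\mathcal{O},\mathcal{O}V,P\rangle$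 where $V$ is a finite set of events; $P$ a finite set of boolean variables; $L:V\to P^*$; $\mathcal{O}V\subseteq V$ is the set of observation events; $\mathcal{O}:P\to\mathcal{O}V$ is a bijection, $\mathcal{O}_p:=\mathcal{O}(p)$; and $\mathcal{A}$ is a finite set of labeled hyper constraints $A=(t_A,H_A,w_A,L_{H_A})$ with tail $t_A\in V$, nonempty set of heads $H_A\subseteq V\setminus\{t_A\}$, integer weights $w_A:H_A\to\mathbb{Z}$, and labels $L_{H_A}:H_A\to P^*$ (a constraint with one head $h$, weight $w$ and label $\ell$ is called standard and is also written $\langle h-t_A\le w,\ell\rangle$). It must satisfy: (WD1') each $L_{H_A}(h)$ is satisfiable and subsumes $L(t_A)$ and $L(h)$; (WD2) whenever $p$ or $\neg p$ appears in $L(u)$, $\mathrm{Sub}(L(u),L(\mathcal{O}_p))$ and the standard constraint $\langle\mathcal{O}_p-u\le-\epsilon_0,L(u)\rangle$ is in $\mathcal{A}$ for some $\epsilon_0>0$ (an integer, since weights are integers); (WD3') whenever $p$ or $\neg p$ appears in some $L_{H_A}(h)$, $\mathrm{Sub}(L_{H_A}(h),L(\mathcal{O}_p))$. $m_{\mathcal{A}}=\sum_{A\in\mathcal{A}}(|H_A|+1)$. Scenarios and dynamic consistency. A scenario is a map $s:P\to\{\top,\bot\}$; $\Sigma_P$ is the set of scenarios; $s(\ell)$ is the truth value of $\ell$ under $s$. $V^+_s=\{v\in V:s(L(v))=\top\}$, $V^+_{s_1,s_2}=V^+_{s_1}\cap V^+_{s_2}$. The restriction $\mathcal{A}^+_s$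 consists of the hyperarcs $(t_A,H'_A,w_A|_{H'_A})$, $A\in\mathcal{A}$, where $H'_A=\{h\in H_A:s(L_{H_A}(h))=\top\}$ is nonempty. An execution strategy $\sigma$ assigns to each $s\in\Sigma_P$ a schedule $\sigma(s):V^+_s\to\mathbb{R}$, values written $[\sigma(s)]_v$. It is viable if for every $s$ and every $(t,H,w)\in\mathcal{A}^+_s$, $[\sigma(s)]_t\ge\min_{v\in H}\{[\sigma(s)]_v-w(v)\}$. $\mathrm{scHst}(v,s,\sigma)=\{(p,s(p)):p\in P,\ \mathcal{O}_p\in V^+_s,\ [\sigma(s)]_{\mathcal{O}_p}<[\sigma(s)]_v\}$; $\mathrm{Con}(\mathrm{scHst}(v,s_1,\sigma),s_2)$ means $s_2(p)=s_1(p)$ for every $p$ occurring in it. $\sigma$ is dynamic if for all $s_1,s_2\in\Sigma_P$ and $v\in V^+_{s_1,s_2}$: $\mathrm{Con}(\mathrm{scHst}(v,s_1,\sigma),s_2)\Rightarrow[\sigma(s_1)]_v=[\sigma(s_2)]_v$. $\Gamma$ is dynamically-consistent if it admits a viable and dynamic execution strategy. The HyTN $\mathcal{H}_\epsilon(\Gamma)$. For $v\in V$, $s\in\Sigma_P$ write $v_s=(v,s)$. The node set is $\{v_s: s\in\Sigma_P, v\in V^+_s\}$. The hyperarcs are: (a) for each $s\in\Sigma_P$ and each $(t,H,w)\in\mathcal{A}^+_s$, the hyperarc with tail $t_s$, heads $\{h_s:h\in H\}$ and weights $h_s\mapsto w(h)$; (b) for all $s_1,s_2\in\Sigma_P$ and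 $u\in V^+_{s_1,s_2}$, the hyperarc $\alpha_\epsilon(s_1;s_2;u)$ with tail $u_{s_1}$, heads $\{u_{s_2}\}\cup\{v_{s_1}:v\in\Delta(s_1;s_2)\}$, weight $0$ on $u_{s_2}$ and weight $-\epsilon$ on each $v_{s_1}$, where $\Delta(s_1;s_2)=\{\mathcal{O}_p\in V^+_{s_1}:s_1(p)\ne s_2(p)\}$. (In these hyperarcs the tail is allowed to occur among the heads.) Asymptotic bounds are with absolute constants, for parameters at least $1$. -}

module Defs where

open import Data.Bool using (Bool; true; false; _∧_; T)
open import Data.Bool.Properties using (T?; T-∧; T-irrelevant)
import Data.Bool.Properties as Bool
open import Data.Empty using (⊥-elim)
open import Data.Fin using (Fin)
import Data.Fin.Properties as Fin
open import Data.Fin.Subset using (Subset; _⊆_; ∁; _∪_) renaming (_∈_ to _∈ₛ_)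
open import Data.Fin.Subset.Properties using (_⊆?_)
open import Data.Integer using (ℤ; 0ℤ) renaming (-_ to -ℤ_; _<_ to _<ℤ_)
open import Data.List using (List; []; _∷_; _++_; map; concatMap; filter; allFin;
  cartesianProduct; catMaybes; length; deduplicate)
open import Data.List.Membership.Propositional using (_∈_; mapWith∈)
open import Data.List.Membership.Propositional.Properties
  using (∈-++⁺ˡ; ∈-++⁺ʳ; ∈-map⁺; ∈-map⁻; ∈-cartesianProduct⁺; ∈-allFin; map-mapWith∈; mapWith∈-id)
open import Data.List.NonEmpty using (List⁺; _∷_; toList; foldr₁) renaming (map to map⁺)
open import Data.List.Relation.Binary.Permutation.Propositional using (_↭_)
open import Data.List.Relation.Unary.All as All using (All; []; _∷_)
import Data.List.Relation.Unary.All.Properties as All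
open import Data.List.Relation.Unary.AllPairs as AllPairs using (AllPairs; []; _∷_)
import Data.List.Relation.Unary.AllPairs.Properties as AllPairs
open import Data.List.Relation.Unary.Any using (here; there)
open import Data.List.Relation.Unary.Enumerates.Setoid using (IsEnumeration)
open import Data.List.Relation.Unary.Unique.Propositional using (Unique)
import Data.List.Relation.Unary.Unique.Propositional.Properties as Unique
open import Data.Maybe using (Maybe; just; nothing)
open import Data.Nat as ℕ using (ℕ; zero; suc)
open import Data.Nat.ListAction using (sum)
import Data.Nat.Properties as ℕ
open import Data.Product using (Σ; ∃; _×_; _,_; proj₁; proj₂)
import Data.Product.Properties as Product
open import Data.Rational as ℚ using (ℚ; 0ℚ; ½; _/_)
import Data.Rational.Properties as ℚ
open import Data.Rational.Solver using (module +-*-Solver)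
open import Data.Sum using (inj₁; inj₂)
open import Data.Vec using (Vec; []; _∷_; lookup)
import Data.Vec.Properties as Vec
import Data.Vec.Properties.WithK as Vec
open import Function using (_∘_; _on_; _⤖_; module Bijection; module Equivalence)
open import Function.Definitions using (Injective)
open import Relation.Binary using (DecidableEquality)
open import Relation.Binary.PropositionalEquality
  using (_≡_; _≢_; refl; sym; trans; cong; subst; subst₂; setoid)
open import Relation.Nullary using (¬_; yes; no; does; ¬?)
open import Relation.Unary using (Pred)
open import Level using (0ℓ)

-- Cauchy sequences of rationals.  Equality of reals is _≃ℝ_, not _≡_.
record ℝ : Set where
  constructor mkℝ
  field
    seq    : ℕ → ℚ
    cauchy : ∀ ε → 0ℚ ℚ.< ε →
             ∃ λ N → ∀ m n → N ℕ.≤ m → N ℕ.≤ n → ℚ.∣ seq m ℚ.- seq n ∣ ℚ.≤ ε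
open ℝ public

infix 4 _≃ℝ_ _≤ℝ_ _<ℝ_

_≃ℝ_ : ℝ → ℝ → Set
x ≃ℝ y = ∀ ε → 0ℚ ℚ.< ε → ∃ λ N → ∀ n → N ℕ.≤ n → ℚ.∣ seq x n ℚ.- seq y n ∣ ℚ.≤ ε

_≤ℝ_ : ℝ → ℝ → Set
x ≤ℝ y = ∀ ε → 0ℚ ℚ.< ε → ∃ λ N → ∀ n → N ℕ.≤ n → seq x n ℚ.≤ seq y n ℚ.+ ε

_<ℝ_ : ℝ → ℝ → Set
x <ℝ y = ∃ λ ε → 0ℚ ℚ.< ε × ∃ λ N → ∀ n → N ℕ.≤ n → seq x n ℚ.+ ε ℚ.≤ seq y n

∣-∣-bound : ∀ {a b e} → a ℚ.≤ b ℚ.+ e → b ℚ.≤ a ℚ.+ e → ℚ.∣ a ℚ.- b ∣ ℚ.≤ e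
∣-∣-bound {a} {b} {e} p q with ℚ.∣p∣≡p∨∣p∣≡-p (a ℚ.- b)
... | inj₁ eq = subst₂ ℚ._≤_ (sym eq)
      (solve 2 (λ b e → (b :+ e) :- b := e) refl b e)
      (ℚ.+-monoˡ-≤ (ℚ.- b) p)
  where open +-*-Solver
... | inj₂ eq = subst₂ ℚ._≤_
      (trans (solve 2 (λ a b → b :- a := :- (a :- b)) refl a b) (sym eq))
      (solve 2 (λ a e → (a :+ e) :- a := e) refl a e)
      (ℚ.+-monoˡ-≤ (ℚ.- a) q)
  where open +-*-Solver

p≤∣p∣ : ∀ p → p ℚ.≤ ℚ.∣ p ∣
p≤∣p∣ p with ℚ.≤-total 0ℚ p
... | inj₁ 0≤p = ℚ.≤-reflexive (sym (ℚ.0≤p⇒∣p∣≡p 0≤p))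
... | inj₂ p≤0 = ℚ.≤-trans p≤0 (ℚ.0≤∣p∣ p)

∣-∣-upper : ∀ {a b e} → ℚ.∣ a ℚ.- b ∣ ℚ.≤ e → a ℚ.≤ b ℚ.+ e
∣-∣-upper {a} {b} {e} p = subst (ℚ._≤ b ℚ.+ e)
  (solve 2 (λ a b → b :+ (a :- b) := a) refl a b)
  (ℚ.+-monoʳ-≤ b (ℚ.≤-trans (p≤∣p∣ (a ℚ.- b)) p))
  where open +-*-Solver

⊓-upper : ∀ {a b c d} e → a ℚ.≤ c ℚ.+ e → b ℚ.≤ d ℚ.+ e →
          a ℚ.⊓ b ℚ.≤ (c ℚ.⊓ d) ℚ.+ e
⊓-upper {a} {b} {c} {d} e p q = subst (a ℚ.⊓ b ℚ.≤_)
  (sym (ℚ.mono-≤-distrib-⊓ (ℚ.+-monoˡ-≤ e) c d)) (ℚ.⊓-mono-≤ p q)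

half-pos : ∀ {ε} → 0ℚ ℚ.< ε → 0ℚ ℚ.< ½ ℚ.* ε
half-pos {ε} p = subst (ℚ._< ½ ℚ.* ε) (ℚ.*-zeroʳ ½) (ℚ.*-monoʳ-<-pos ½ p)

halves : ∀ ε → ½ ℚ.* ε ℚ.+ ½ ℚ.* ε ≡ ε
halves ε = trans (sym (ℚ.*-distribʳ-+ ε ½ ½)) (ℚ.*-identityˡ ε)

swap-∣-∣ : ∀ a b → ℚ.∣ a ℚ.- b ∣ ≡ ℚ.∣ b ℚ.- a ∣
swap-∣-∣ a b = trans (sym (ℚ.∣-p∣≡∣p∣ (a ℚ.- b)))
  (cong ℚ.∣_∣ (solve 2 (λ a b → :- (a :- b) := b :- a) refl a b))
  where open +-*-Solver

fromℚ : ℚ → ℝ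
fromℚ q = mkℝ (λ _ → q) λ ε 0<ε → 0 , λ _ _ _ _ →
  subst (λ r → ℚ.∣ r ∣ ℚ.≤ ε) (sym (ℚ.+-inverseʳ q)) (ℚ.<⇒≤ 0<ε)

fromℤ : ℤ → ℝ
fromℤ z = fromℚ (z / 1)

0ℝ : ℝ
0ℝ = fromℚ 0ℚ

infix  8 -ℝ_
infixl 6 _+ℝ_ _-ℝ_
infixl 7 _⊓ℝ_

-ℝ_ : ℝ → ℝ
-ℝ x = mkℝ (λ n → ℚ.- seq x n) λ ε 0<ε → let N , h = cauchy x ε 0<ε in
  N , λ m n N≤m N≤n → subst (ℚ._≤ ε) (eq (seq x n) (seq x m)) (h n m N≤n N≤m)
  where
  open +-*-Solver
  eq : ∀ a b → ℚ.∣ a ℚ.- b ∣ ≡ ℚ.∣ ℚ.- b ℚ.- (ℚ.- a) ∣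
  eq a b = cong ℚ.∣_∣ (solve 2 (λ a b → a :- b := (:- b) :- (:- a)) refl a b)

_+ℝ_ : ℝ → ℝ → ℝ
x +ℝ y = mkℝ (λ n → seq x n ℚ.+ seq y n) λ ε 0<ε →
  let M , f = cauchy x (½ ℚ.* ε) (half-pos 0<ε)
      N , g = cauchy y (½ ℚ.* ε) (half-pos 0<ε)
  in M ℕ.⊔ N , λ m n p q →
    subst₂ ℚ._≤_ (eq (seq x m) (seq x n) (seq y m) (seq y n)) (halves ε)
      (ℚ.≤-trans (ℚ.∣p+q∣≤∣p∣+∣q∣ (seq x m ℚ.- seq x n) (seq y m ℚ.- seq y n))
        (ℚ.+-mono-≤
          (f m n (ℕ.m⊔n≤o⇒m≤o M N p) (ℕ.m⊔n≤o⇒m≤o M N q))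
          (g m n (ℕ.m⊔n≤o⇒n≤o M N p) (ℕ.m⊔n≤o⇒n≤o M N q))))
  where
  open +-*-Solver
  eq : ∀ a b c d → ℚ.∣ (a ℚ.- b) ℚ.+ (c ℚ.- d) ∣ ≡ ℚ.∣ (a ℚ.+ c) ℚ.- (b ℚ.+ d) ∣
  eq a b c d = cong ℚ.∣_∣
    (solve 4 (λ a b c d → (a :- b) :+ (c :- d) := (a :+ c) :- (b :+ d)) refl a b c d)

_-ℝ_ : ℝ → ℝ → ℝ
x -ℝ y = x +ℝ (-ℝ y)

_⊓ℝ_ : ℝ → ℝ → ℝ
x ⊓ℝ y = mkℝ (λ n → seq x n ℚ.⊓ seq y n) λ ε 0<ε →
  let M , f = cauchy x ε 0<ε
      N , g = cauchy y ε 0<ε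
      upper : ∀ m n → M ℕ.⊔ N ℕ.≤ m → M ℕ.⊔ N ℕ.≤ n →
              seq x m ℚ.⊓ seq y m ℚ.≤ (seq x n ℚ.⊓ seq y n) ℚ.+ ε
      upper m n p q = ⊓-upper {seq x m} {seq y m} {seq x n} {seq y n} ε
        (∣-∣-upper {seq x m} {seq x n} (f m n (ℕ.m⊔n≤o⇒m≤o M N p) (ℕ.m⊔n≤o⇒m≤o M N q)))
        (∣-∣-upper {seq y m} {seq y n} (g m n (ℕ.m⊔n≤o⇒n≤o M N p) (ℕ.m⊔n≤o⇒n≤o M N q)))
  in M ℕ.⊔ N , λ m n p q → ∣-∣-bound {seq x m ℚ.⊓ seq y m} (upper m n p q) (upper n m q p)

minℝ : List⁺ ℝ → ℝ
minℝ = foldr₁ _⊓ℝ_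

module _ {A : Set} (f : A → Bool) where

  retain : List A → List (∃ (T ∘ f))
  retain []       = []
  retain (x ∷ xs) with T? (f x)
  ... | yes t = (x , t) ∷ retain xs
  ... | no  _ = retain xs

  retain-∈ : ∀ {x xs} (t : T (f x)) → x ∈ xs → (x , t) ∈ retain xs
  retain-∈ {x} {_ ∷ xs} t (here refl) with T? (f x)
  ... | yes t′ = here (cong (x ,_) (T-irrelevant t t′))
  ... | no ¬t  = ⊥-elim (¬t t)
  retain-∈ {x} {y ∷ xs} t (there i) with T? (f y)
  ... | yes _ = there (retain-∈ t i)
  ... | no  _ = retain-∈ t i

  retain-All : ∀ {P : Pred A 0ℓ} {xs} → All P xs → All (P ∘ proj₁) (retain xs)
  retain-All []                   = []
  retain-All {xs = x ∷ _} (p ∷ ps) with T? (f x)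
  ... | yes _ = p ∷ retain-All ps
  ... | no  _ = retain-All ps

  retain-AllPairs : ∀ {R : A → A → Set} {xs} →
                    AllPairs R xs → AllPairs (R on proj₁) (retain xs)
  retain-AllPairs []                   = []
  retain-AllPairs {xs = x ∷ _} (r ∷ rs) with T? (f x)
  ... | yes _ = retain-All r ∷ retain-AllPairs rs
  ... | no  _ = retain-AllPairs rs

  retain-unique : ∀ {xs} → Unique xs → Unique (retain xs)
  retain-unique u = AllPairs.map (_∘ cong proj₁) (retain-AllPairs u)

  retained-≟ : DecidableEquality A → DecidableEquality (∃ (T ∘ f))
  retained-≟ _≟_ = Product.≡-dec _≟_ (λ t t′ → yes (T-irrelevant t t′))

attach : ∀ {A : Set} (xs : List A) → List (∃ (_∈ xs))
attach xs = mapWith∈ xs (_ ,_)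

attach-AllPairs : ∀ {A : Set} {R : A → A → Set} {xs} →
                  AllPairs R xs → AllPairs (R on proj₁) (attach xs)
attach-AllPairs {R = R} {xs} r = unmap (attach xs)
  (subst (AllPairs R) (sym (trans (map-mapWith∈ xs _ proj₁) (mapWith∈-id xs))) r)
  where
  unmap : ∀ ys → AllPairs R (map proj₁ ys) → AllPairs (R on proj₁) ys
  unmap []       []       = []
  unmap (_ ∷ ys) (p ∷ ps) = All.map⁻ p ∷ unmap ys ps

record Hyperarc (Node : Set) : Set where
  field
    tail     : Node
    heads    : List⁺ (Node × ℝ)
    distinct : AllPairs (_≢_ on proj₁) (toList heads)

Schedule : Set → Set
Schedule Node = Node → ℝ

Satisfies : ∀ {Node} → Schedule Node → Hyperarc Node → Set
Satisfies φ a = minℝ (map⁺ (λ (v , w) → φ v -ℝ w) heads) ≤ℝ φ tail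
  where open Hyperarc a

-- The list of arcs stands for the set of its members.  It may contain
-- repetitions, so arcCount and size bound the corresponding quantities of
-- that set from above.
record HyTN : Set₁ where
  field
    Node        : Set
    _≟_         : DecidableEquality Node
    nodes       : List Node
    complete    : IsEnumeration (setoid Node) nodes
    irredundant : Unique nodes
    arcs        : List (Hyperarc Node)

  nodeCount : ℕ
  nodeCount = length nodes

  arcCount : ℕ
  arcCount = length arcs

  size : ℕ
  size = sum (map (λ a → length (deduplicate _≟_
    (Hyperarc.tail a ∷ map proj₁ (toList (Hyperarc.heads a))))) arcs)

Consistent : HyTN → Set
Consistent H = ∃ λ (φ : Schedule Node) → All (Satisfies φ) arcs
  where open HyTN H

mapArc : ∀ {A B : Set} (f : A → B) → Injective _≡_ _≡_ f → Hyperarc A → Hyperarc B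
mapArc f f-inj a = record
  { tail     = f tail
  ; heads    = map⁺ (λ (v , w) → f v , w) heads
  ; distinct = AllPairs.map⁺ (AllPairs.map (_∘ f-inj) distinct)
  }
  where open Hyperarc a

-- The conjunction of the literals p (p ∈ positive) and ¬ p (p ∈ negative).
-- It is unsatisfiable when the two sets meet.
record Label (m : ℕ) : Set where
  field
    positive negative : Subset m
open Label

_occursIn_ : ∀ {m} → Fin m → Label m → Set
p occursIn ℓ = p ∈ₛ positive ℓ ∪ negative ℓ

Scenario : ℕ → Set
Scenario m = Vec Bool m

-- A scenario is also the subset of the variables it makes true.
_⟦_⟧ : ∀ {m} → Scenario m → Label m → Bool
s ⟦ ℓ ⟧ = does (positive ℓ ⊆? s) ∧ does (negative ℓ ⊆? ∁ s)

Satisfiable : ∀ {m} → Label m → Set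
Satisfiable ℓ = ∃ λ s → T (s ⟦ ℓ ⟧)

Sub : ∀ {m} → Label m → Label m → Set
Sub ℓ₁ ℓ₂ = ∀ s → T (s ⟦ ℓ₁ ⟧) → T (s ⟦ ℓ₂ ⟧)

scenarios : ∀ m → List (Scenario m)
scenarios zero    = [] ∷ []
scenarios (suc m) = map (true ∷_) (scenarios m) ++ map (false ∷_) (scenarios m)

scenarios-complete : ∀ m → IsEnumeration (setoid (Scenario m)) (scenarios m)
scenarios-complete zero    []          = here refl
scenarios-complete (suc m) (true  ∷ s) = ∈-++⁺ˡ (∈-map⁺ (true ∷_) (scenarios-complete m s))
scenarios-complete (suc m) (false ∷ s) =
  ∈-++⁺ʳ (map (true ∷_) (scenarios m)) (∈-map⁺ (false ∷_) (scenarios-complete m s))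

scenarios-unique : ∀ m → Unique (scenarios m)
scenarios-unique zero    = [] ∷ []
scenarios-unique (suc m) = Unique.++⁺
  (Unique.map⁺ Vec.∷-injectiveʳ (scenarios-unique m))
  (Unique.map⁺ Vec.∷-injectiveʳ (scenarios-unique m))
  λ (i , j) → case-≢ (∈-map⁻ (true ∷_) i) (∈-map⁻ (false ∷_) j)
  where
  case-≢ : ∀ {s} → (∃ λ t → t ∈ scenarios m × s ≡ true ∷ t) →
           ¬ (∃ λ t → t ∈ scenarios m × s ≡ false ∷ t)
  case-≢ (_ , _ , refl) (_ , _ , ())

record LabeledHead (n m : ℕ) : Set where
  field
    event  : Fin n
    weight : ℤ
    label  : Label m

-- The heads list the finite maps w_A and L_{H_A} on their common domain H_A.
record HyperConstraint (n m : ℕ) : Set where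
  field
    tail  : Fin n
    heads : List⁺ (LabeledHead n m)

-- ⟨ h − t ≤ w , ℓ ⟩
standard : ∀ {n m} → (h t : Fin n) → ℤ → Label m → HyperConstraint n m
standard h t w ℓ = record
  { tail  = t
  ; heads = record { event = h ; weight = w ; label = ℓ } ∷ []
  }

_≈ᶜ_ : ∀ {n m} → HyperConstraint n m → HyperConstraint n m → Set
A ≈ᶜ B = tail A ≡ tail B × toList (heads A) ↭ toList (heads B)
  where open HyperConstraint

record CHyTN : Set where
  open LabeledHead
  open HyperConstraint
  field
    ∣V∣ ∣P∣ : ℕ
    L   : Fin ∣V∣ → Label ∣P∣
    𝒪V  : Subset ∣V∣
    𝒪   : Fin ∣P∣ ⤖ ∃ (_∈ₛ 𝒪V)
    𝒜   : List (HyperConstraint ∣V∣ ∣P∣)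

  obs : Fin ∣P∣ → Fin ∣V∣
  obs p = proj₁ (Bijection.to 𝒪 p)

  field
    𝒜-irredundant  : AllPairs (λ A B → ¬ (A ≈ᶜ B)) 𝒜
    heads-distinct : ∀ {A} → A ∈ 𝒜 → AllPairs (_≢_ on event) (toList (heads A))
    tail∉heads     : ∀ {A h} → A ∈ 𝒜 → h ∈ toList (heads A) → event h ≢ tail A
    WD1′ : ∀ {A h} → A ∈ 𝒜 → h ∈ toList (heads A) →
           Satisfiable (label h) × Sub (label h) (L (tail A)) × Sub (label h) (L (event h))
    WD2  : ∀ u p → p occursIn L u →
           Sub (L u) (L (obs p)) ×
           ∃ λ ε₀ → 0ℤ <ℤ ε₀ × standard (obs p) u (-ℤ ε₀) (L u) ∈ 𝒜
    WD3′ : ∀ {A h} → A ∈ 𝒜 → h ∈ toList (heads A) → ∀ p → p occursIn label h →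
           Sub (label h) (L (obs p))

  obs-injective : Injective _≡_ _≡_ obs
  obs-injective eq = Bijection.injective 𝒪
    (Product.Σ-≡,≡→≡ (eq , Vec.[]=-irrelevant _ _))

  ∣𝒜∣ : ℕ
  ∣𝒜∣ = length 𝒜

  m𝒜 : ℕ
  m𝒜 = sum (map (λ A → length (toList (heads A)) ℕ.+ 1) 𝒜)

  Σ-P : List (Scenario ∣P∣)
  Σ-P = scenarios ∣P∣

  ∣Σ-P∣ : ℕ
  ∣Σ-P∣ = length Σ-P

  V⁺ : Scenario ∣P∣ → Set
  V⁺ s = ∃ λ v → T (s ⟦ L v ⟧)

  -- nothing when no head of A is labeled true by s; otherwise WD1′ puts the tail
  -- and the surviving heads in V⁺ s.
  restrict : ∀ s {A} → A ∈ 𝒜 → Maybe (Hyperarc (V⁺ s))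
  restrict s {A} A∈𝒜 = build active active-distinct
    where
    Head : Set
    Head = ∃ (_∈ toList (heads A))

    Active : Set
    Active = ∃ λ (h : Head) → T (s ⟦ label (proj₁ h) ⟧)

    active : List Active
    active = retain _ (attach (toList (heads A)))

    active-distinct : AllPairs (_≢_ on (event ∘ proj₁ ∘ proj₁)) active
    active-distinct = retain-AllPairs _ (attach-AllPairs (heads-distinct A∈𝒜))

    tailNode : Active → V⁺ s
    tailNode ((_ , h∈) , t) = tail A , proj₁ (proj₂ (WD1′ A∈𝒜 h∈)) s t

    headNode : Active → V⁺ s × ℝ
    headNode ((h , h∈) , t) = (event h , proj₂ (proj₂ (WD1′ A∈𝒜 h∈)) s t) , fromℤ (weight h)

    build : (hs : List Active) → AllPairs (_≢_ on (event ∘ proj₁ ∘ proj₁)) hs →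
            Maybe (Hyperarc (V⁺ s))
    build []       _ = nothing
    build (h ∷ hs) d = just record
      { tail     = tailNode h
      ; heads    = map⁺ headNode (h ∷ hs)
      ; distinct = AllPairs.map⁺ (AllPairs.map (_∘ cong proj₁) d)
      }

  𝒜⁺ : ∀ s → List (Hyperarc (V⁺ s))
  𝒜⁺ s = catMaybes (mapWith∈ 𝒜 (restrict s))

  Strategy : Set
  Strategy = ∀ s → Schedule (V⁺ s)

  Viable : Strategy → Set
  Viable σ = ∀ s → All (Satisfies (σ s)) (𝒜⁺ s)

  History : Set₁
  History = Pred (Fin ∣P∣ × Bool) 0ℓ

  scHst : ∀ s → V⁺ s → Strategy → History
  scHst s v σ (p , b) = b ≡ lookup s p ×
    Σ (T (s ⟦ L (obs p) ⟧)) λ t → σ s (obs p , t) <ℝ σ s v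

  Con : History → Scenario ∣P∣ → Set
  Con hst s = ∀ p b → hst (p , b) → lookup s p ≡ b

  Dynamic : Strategy → Set
  Dynamic σ = ∀ s₁ s₂ v (t₁ : T (s₁ ⟦ L v ⟧)) (t₂ : T (s₂ ⟦ L v ⟧)) →
    Con (scHst s₁ (v , t₁) σ) s₂ → σ s₁ (v , t₁) ≃ℝ σ s₂ (v , t₂)

  DynamicallyConsistent : Set
  DynamicallyConsistent = ∃ λ σ → Viable σ × Dynamic σ

  Δ : ∀ s₁ → Scenario ∣P∣ → List (V⁺ s₁)
  Δ s₁ s₂ = retain _ (map obs
    (filter (λ p → ¬? (lookup s₁ p Bool.≟ lookup s₂ p)) (allFin ∣P∣)))

  Node : Set
  Node = ∃ λ ((v , s) : Fin ∣V∣ × Scenario ∣P∣) → T (s ⟦ L v ⟧)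

  node : ∀ s → V⁺ s → Node
  node s (v , t) = (v , s) , t

  node-injective : ∀ s → Injective _≡_ _≡_ (node s)
  node-injective s {_ , t} {_ , t′} eq with refl ← cong (proj₁ ∘ proj₁) eq =
    cong (_ ,_) (T-irrelevant t t′)

  α : ℝ → ∀ s₁ s₂ u → T (s₁ ⟦ L u ⟧) → T (s₂ ⟦ L u ⟧) → Hyperarc Node
  α ε s₁ s₂ u t₁ t₂ = record
    { tail     = node s₁ (u , t₁)
    ; heads    = (node s₂ (u , t₂) , 0ℝ) ∷ map (λ v → node s₁ v , -ℝ ε) (Δ s₁ s₂)
    ; distinct = All.map⁺ (All.map (λ s₁≢s₂ eq → s₁≢s₂ (sym (cong (proj₂ ∘ proj₁) eq))) differ)
               ∷ AllPairs.map⁺ (AllPairs.map (_∘ node-injective s₁) Δ-unique)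
    }
    where
    differ : All (λ _ → s₁ ≢ s₂) (Δ s₁ s₂)
    differ = retain-All _ (All.map⁺
      (All.map (λ p≢ eq → p≢ (cong (λ s → lookup s _) eq))
        (All.all-filter _ (allFin ∣P∣))))

    Δ-unique : Unique (Δ s₁ s₂)
    Δ-unique = retain-unique _
      (Unique.map⁺ obs-injective (Unique.filter⁺ _ (Unique.allFin⁺ ∣P∣)))

  scenarioArcs : List (Hyperarc Node)
  scenarioArcs = concatMap (λ s → map (mapArc (node s) (node-injective s)) (𝒜⁺ s)) Σ-P

  dynamicArcs : ℝ → List (Hyperarc Node)
  dynamicArcs ε = concatMap (λ (s₁ , s₂) →
    map (λ (u , t) → let t₁ , t₂ = Equivalence.to T-∧ t in α ε s₁ s₂ u t₁ t₂)
        (retain (λ u → s₁ ⟦ L u ⟧ ∧ s₂ ⟦ L u ⟧) (allFin ∣V∣)))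
    (cartesianProduct Σ-P Σ-P)

  ℋ : ℝ → HyTN
  ℋ ε = record
    { Node        = Node
    ; _≟_         = retained-≟ _ (Product.≡-dec Fin._≟_ (Vec.≡-dec Bool._≟_))
    ; nodes       = retain _ (cartesianProduct (allFin ∣V∣) Σ-P)
    ; complete    = λ ((v , s) , t) → retain-∈ _ t
                      (∈-cartesianProduct⁺ (∈-allFin v) (scenarios-complete ∣P∣ s))
    ; irredundant = retain-unique _
                      (Unique.cartesianProduct⁺ (Unique.allFin⁺ ∣V∣) (scenarios-unique ∣P∣))
    ; arcs        = scenarioArcs ++ dynamicArcs ε
    }

{-# OPTIONS --safe #-}

-- A schedule φ of ℋ ε yields the strategy σ(s)(v) = φ(v_s), whatever ε > 0 is.
-- It is dynamic because the earliest observation under one scenario that tells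
-- it from another is made no later under the other.
--
-- Conversely let φ come from a strategy, let n be the number of nodes and put
-- ε = 1/n.  The integers ψ(a) = Σ_b ⌈φ(a) − φ(b)⌉ turn φ(a) ≤ φ(b) + w, for an
-- integer w, into ψ(a) ≤ ψ(b) + n w, and φ(a) < φ(b) into ψ(a) + 1 ≤ ψ(b), so that
-- ψ/n is a schedule of ℋ ε.  Constructively the ceilings exist only up to double
-- negation.  But ψ solves a finite system of min-constraints over the integers,
-- any solution of which can be compressed into a range known in advance;
-- solvability is therefore decidable, and the double negation can be dropped.
module Submission where

open import Defs
open import Data.Nat using (ℕ; _+_; _*_; _^_; _≤_)
open import Data.Product using (∃; _×_)
open import Function using (_⇔_)

open import Data.Bool using (Bool; true; false; T; _∧_; if_then_else_)
open import Data.Bool.Properties using (T?; T-∧; T-irrelevant)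
import Data.Bool.Properties as Bool
open import Data.Fin using (Fin; toℕ; fromℕ<)
open import Data.Fin.Induction using (spo-wellFounded)
import Data.Fin.Properties as Fin
open import Data.Fin.Subset using (∁) renaming (_∈_ to _∈ₛ_)
open import Data.Fin.Subset.Properties using (_⊆?_; p⊆p∪q; q⊆p∪q; x∈∁p⇒x∉p; x∉p⇒x∈∁p)
open import Data.Integer as ℤ using (ℤ; +_; -[1+_]; 0ℤ; 1ℤ; -1ℤ; ∣_∣)
import Data.Integer.Properties as ℤ
open import Data.Integer.Solver renaming (module +-*-Solver to ℤ-Solver)
open import Data.List as List using (List; []; _∷_; _++_; length; map; foldr; filter;
  concatMap; catMaybes; cartesianProduct; allFin; deduplicate)
open import Data.List.Membership.Propositional using (_∈_; find; lose; mapWith∈)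
open import Data.List.Membership.Propositional.Properties
  using (∈-map⁺; ∈-filter⁺; ∈-allFin; ∈-cartesianProduct⁺)
open import Data.List.Membership.Setoid.Properties using (length-mapWith∈)
open import Data.List.NonEmpty using (List⁺; _∷_; toList) renaming (map to map⁺)
import Data.List.NonEmpty.Properties as List⁺
open import Data.List.Properties
  using (length-map; length-filter; length-tabulate; length-++; map-++; map-∘)
open import Data.List.Relation.Binary.Pointwise as Pointwise using (Pointwise; []; _∷_)
open import Data.List.Relation.Unary.All as All using (All; []; _∷_)
import Data.List.Relation.Unary.All.Properties as All
open import Data.List.Relation.Unary.AllPairs using ([]; _∷_)
open import Data.List.Relation.Unary.Any as Any using (Any; here; there)
import Data.List.Relation.Unary.Any.Properties as Any
open import Data.Maybe using (Maybe; just; nothing)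
open import Data.Maybe.Relation.Unary.All as Maybe using (just; nothing)
open import Data.Nat as ℕ using (zero; suc; _∸_; _⊓_; _<_; z≤n; s≤s)
open import Data.Nat.Induction using (<-rec)
open import Data.Nat.ListAction using (sum)
open import Data.Nat.ListAction.Properties using (sum-++)
open import Data.Nat.Properties
open import Data.Nat.Solver renaming (module +-*-Solver to ℕ-Solver)
open import Data.Product using (_,_; proj₁; proj₂)
open import Data.Rational as ℚ using (ℚ; 0ℚ; 1ℚ; ½; _/_; toℚᵘ)
import Data.Rational.Properties as ℚ
open import Data.Rational.Solver renaming (module +-*-Solver to ℚ-Solver)
open import Data.Rational.Unnormalised as ℚᵘ using (mkℚᵘ; *≡*; *≤*; *<*)
import Data.Rational.Unnormalised.Properties as ℚᵘ
open import Data.Sum using (_⊎_; inj₁; inj₂)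
open import Data.Vec as Vec using (Vec; []; _∷_; lookup)
import Data.Vec.Properties as Vec
open import Function using (_∘_; mk⇔; module Equivalence)
open import Function.Definitions using (Injective)
open import Induction.WellFounded using (Acc; acc)
open import Level using (0ℓ)
open import Relation.Binary using (DecidableEquality; IsStrictPartialOrder; REL)
open import Relation.Binary.PropositionalEquality
open import Relation.Nullary
open import Relation.Nullary.Decidable using (decidable-stable; map′; _×-dec_)
open import Relation.Nullary.Negation using (¬¬-map)
open import Relation.Unary using (Pred; Decidable)

-- Hyperarcs with integer weights

-- The number `ε` has to be fixed before any strategy is known, and a strategy may separate events
-- by arbitrarily small amounts; rounding gives every strict precedence a uniform length. It works
-- because, for an integer `w`, `φ(a) ≤ φ(b) + w` implies `⌈φ(a) − φ(x)⌉ ≤ ⌈φ(b) − φ(x)⌉ + w` at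
-- every node `x`, which adds up to `n w` over the `n` nodes; and when `φ(a) < φ(b)`, the term at
-- `x = a` is `0` for `a` but at least `1` for `b`. A single ceiling per node would not do, since it
-- may merge distinct times. Dividing by `n` restores the weights and leaves gaps of at least `1/n`.
-- A bound on a minimum of Cauchy reals does not reveal which term obeys it. Over the integers that
-- choice is decidable, so each arc is translated into an integer arc, and facts known about `φ`
-- only up to double negation suffice there. The solution found by search need not be a rounding of
-- `φ`; only the integer constraints are carried over.

all-≤-sum : ∀ ns → All (_≤ sum ns) ns
all-≤-sum []       = []
all-≤-sum (n ∷ ns) =
  m≤m+n n (sum ns) ∷ All.map (λ m≤ → ≤-trans m≤ (m≤n+m (sum ns) n)) (all-≤-sum ns)

anyVec? : ∀ {k} n {P : Vec (Fin k) n → Set} → (∀ v → Dec (P v)) → Dec (∃ P)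
anyVec? zero    P? = map′ ([] ,_) (λ { ([] , p) → p }) (P? [])
anyVec? (suc n) P? = map′ (λ (x , v , p) → x ∷ v , p) (λ { (x ∷ v , p) → x , v , p })
  (Fin.any? λ x → anyVec? n λ v → P? (x ∷ v))

module _ {P : Pred ℕ 0ℓ} (P? : Decidable P) where

  count : ℕ → ℕ
  count zero    = 0
  count (suc n) = (if does (P? n) then 1 else 0) + count n

  count-suc : ∀ n → count n ≤ count (suc n)
  count-suc n = m≤n+m (count n) _

  count-mono : ∀ {m n} → m ≤ n → count m ≤ count n
  count-mono {m} m≤n = go (≤⇒≤′ m≤n)
    where
    go : ∀ {n} → m ℕ.≤′ n → count m ≤ count n
    go ℕ.≤′-refl         = ≤-refl
    go (ℕ.≤′-step m≤′n) = ≤-trans (go m≤′n) (count-suc _)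

  -- Counting is 1-Lipschitz, so compression never lengthens a distance; this keeps the constraints
  -- of nonnegative weight.
  count-+ : ∀ k n → count (k + n) ≤ k + count n
  count-+ zero    n = ≤-refl
  count-+ (suc k) n with does (P? (k + n))
  ... | true  = s≤s (count-+ k n)
  ... | false = m≤n⇒m≤1+n (count-+ k n)

  -- The opposite bound, on a stretch where every point is kept; it protects the constraints of
  -- negative weight, which demand a distance.
  count-full : ∀ k n → (∀ {i} → n ≤ i → i < k + n → P i) → k + count n ≤ count (k + n)
  count-full zero    n p = ≤-refl
  count-full (suc k) n p with P? (k + n)
  ... | yes _ = s≤s (count-full k n (λ n≤i i<k+n → p n≤i (m<n⇒m<1+n i<k+n)))
  ... | no ¬p = contradiction (p (m≤n+m n k) ≤-refl) ¬p

  count-accept : ∀ {n} → P n → count (suc n) ≡ suc (count n)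
  count-accept {n} p with P? n
  ... | yes _ = refl
  ... | no ¬p = contradiction p ¬p

  count-reject : ∀ {n} → ¬ P n → count (suc n) ≡ count n
  count-reject {n} ¬p with P? n
  ... | yes p = contradiction p ¬p
  ... | no  _ = refl

count-none : ∀ {P : Pred ℕ 0ℓ} (P? : Decidable P) → (∀ i → ¬ P i) → ∀ n → count P? n ≡ 0
count-none P? ¬p zero    = refl
count-none P? ¬p (suc n) with P? n
... | yes p = contradiction p (¬p n)
... | no  _ = count-none P? ¬p n

count-⊎ : ∀ {P Q R : Pred ℕ 0ℓ} (P? : Decidable P) (Q? : Decidable Q) (R? : Decidable R) →
          (∀ {i} → P i → Q i ⊎ R i) → ∀ n → count P? n ≤ count Q? n + count R? n
count-⊎ P? Q? R? split zero = z≤n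
count-⊎ P? Q? R? split (suc n) with ih ← count-⊎ P? Q? R? split n | P? n | Q? n | R? n
... | no _  | q?    | r?    = ≤-trans ih (+-mono-≤
  (m≤n+m (count Q? n) (if does q? then 1 else 0)) (m≤n+m (count R? n) (if does r? then 1 else 0)))
... | yes _ | yes _ | r?    = s≤s (≤-trans ih (+-monoʳ-≤ (count Q? n)
  (m≤n+m (count R? n) (if does r? then 1 else 0))))
... | yes _ | no _  | yes _ = ≤-trans (s≤s ih) (≤-reflexive (sym (+-suc _ _)))
... | yes p | no ¬q | no ¬r with split p
...   | inj₁ q = contradiction q ¬q
...   | inj₂ r = contradiction r ¬r

module Window (W : ℕ) where

  -- The lower end `top - W` is moved across the inequality, as it may be negative.
  Window : ℕ → Pred ℕ 0ℓ
  Window top i = i < top × top ≤ i + W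

  window? : ∀ top → Decidable (Window top)
  window? top i = (i <? top) ×-dec (top ≤? i + W)

  -- The added term `W ⊓ (top ∸ n)` is the number of window points not below `n`. It makes the bound
  -- inductive: each accepted point passes from one summand to the other.
  count-window : ∀ top n → count (window? top) n + W ⊓ (top ∸ n) ≤ W
  count-window top zero = m⊓n≤m W top
  count-window top (suc n) with ih ← count-window top n | window? top n
  ... | yes (n<top , top≤n+W) = begin
    count (window? top) (suc n) + W ⊓ (top ∸ suc n)
                                 ≡⟨ cong (λ m → m + W ⊓ (top ∸ suc n)) (count-accept (window? top) (n<top , top≤n+W)) ⟩
    suc c + W ⊓ (top ∸ suc n)    ≤⟨ +-monoʳ-≤ (suc c) (m⊓n≤n W _) ⟩
    suc c + (top ∸ suc n)        ≡⟨ +-suc c _ ⟨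
    c + suc (top ∸ suc n)        ≡⟨ cong (λ m → c + m) (+-∸-assoc 1 n<top) ⟨
    c + (top ∸ n)                ≡⟨ cong (λ m → c + m) (m≥n⇒m⊓n≡n (m≤n+o⇒m∸n≤o top n top≤n+W)) ⟨
    c + W ⊓ (top ∸ n)            ≤⟨ ih ⟩
    W                            ∎
    where open ≤-Reasoning
          c = count (window? top) n
  ... | no out = ≤-trans
    (+-mono-≤ (≤-reflexive (count-reject (window? top) out))
              (⊓-monoʳ-≤ W (∸-monoʳ-≤ top (n≤1+n n)))) ih

  Covered : List ℕ → Pred ℕ 0ℓ
  Covered tops i = Any (λ top → Window top i) tops

  covered? : ∀ tops → Decidable (Covered tops)
  covered? tops i = Any.any? (λ top → window? top i) tops

  count-covered : ∀ tops n → count (covered? tops) n ≤ length tops * W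
  count-covered [] n = ≤-reflexive (count-none (covered? []) (λ _ ()) n)
  count-covered (top ∷ tops) n = ≤-trans
    (count-⊎ (covered? (top ∷ tops)) (window? top) (covered? tops) Any.toSum n)
    (+-mono-≤ (m+n≤o⇒m≤o _ (count-window top n)) (count-covered tops n))

cancel-+suc : ∀ a k → a ℤ.+ -[1+ k ] ℤ.+ + suc k ≡ a
cancel-+suc a k = trans (ℤ.+-assoc a -[1+ k ] (+ suc k))
  (trans (cong (λ z → a ℤ.+ z) (ℤ.+-inverseˡ (+ suc k))) (ℤ.+-identityʳ a))

≤-neg⁻ : ∀ {a b k} → + a ℤ.≤ + b ℤ.+ -[1+ k ] → a + suc k ≤ b
≤-neg⁻ {b = b} {k} p =
  ℤ.drop‿+≤+ (subst (_ ℤ.≤_) (cancel-+suc (+ b) k) (ℤ.+-monoˡ-≤ (+ suc k) p))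

≤-neg⁺ : ∀ {a b k} → a + suc k ≤ b → + a ℤ.≤ + b ℤ.+ -[1+ k ]
≤-neg⁺ {a} {b} {k} p = subst (ℤ._≤ + b ℤ.+ -[1+ k ]) eq (ℤ.+-monoˡ-≤ -[1+ k ] (ℤ.+≤+ p))
  where
  eq : + (a + suc k) ℤ.+ -[1+ k ] ≡ + a
  eq = trans (ℤ.+-assoc (+ a) (+ suc k) -[1+ k ])
    (trans (cong (λ z → + a ℤ.+ z) (ℤ.+-inverseʳ (+ suc k))) (ℤ.+-identityʳ (+ a)))

module _ {X : Set} where

  IntArc : Set
  IntArc = X × List (X × ℤ)

  -- Existence of a suitable head stands in for the bound on the minimum; over the integers it is
  -- decidable.
  IntSatisfies : (X → ℕ) → IntArc → Set
  IntSatisfies ψ (t , hs) = Any (λ (h , k) → + ψ h ℤ.≤ + ψ t ℤ.+ k) hs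

  intSatisfies? : ∀ ψ → Decidable (IntSatisfies ψ)
  intSatisfies? ψ (t , hs) = Any.any? (λ (h , k) → + ψ h ℤ.≤? + ψ t ℤ.+ k) hs

  intSatisfies-cong : ∀ {ψ χ} → (∀ x → ψ x ≡ χ x) → ∀ {a} → IntSatisfies ψ a → IntSatisfies χ a
  intSatisfies-cong ψ≗χ {t , _} =
    Any.map λ {(h , k)} → subst₂ (λ m n → + m ℤ.≤ + n ℤ.+ k) (ψ≗χ h) (ψ≗χ t)

  module _ {xs : List X} (complete : ∀ x → x ∈ xs) where

    -- Keep only the points at distance at most W below some value of ψ, and
    -- let every value be the number of points kept below it.
    module Compress (W : ℕ) (ψ : X → ℕ) where
      open Window W

      kept? : Decidable (Covered (map ψ xs))
      kept? = covered? (map ψ xs)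

      compress : X → ℕ
      compress x = count kept? (ψ x)

      compress-≤ : ∀ x → compress x ≤ length xs * W
      compress-≤ x = subst (λ n → compress x ≤ n * W) (length-map ψ xs)
        (count-covered (map ψ xs) (ψ x))

      -- For `k ≥ 0`, deleting points only shortens distances. For `k < 0`, the `∣ k ∣ ≤ W` points
      -- just below `ψ t` all lie in its window, so nothing of the distance demanded is lost.
      compress-diff : ∀ h t k → ∣ k ∣ ≤ W → + ψ h ℤ.≤ + ψ t ℤ.+ k →
                      + compress h ℤ.≤ + compress t ℤ.+ k
      compress-diff h t (+ k) _ ψh≤ = ℤ.+≤+ (begin
        count kept? (ψ h)
          ≤⟨ count-mono kept? (≤-trans (ℤ.drop‿+≤+ ψh≤) (≤-reflexive (+-comm (ψ t) k))) ⟩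
        count kept? (k + ψ t)    ≤⟨ count-+ kept? k (ψ t) ⟩
        k + count kept? (ψ t)    ≡⟨ +-comm k _ ⟩
        count kept? (ψ t) + k    ∎)
        where open ≤-Reasoning
      compress-diff h t -[1+ k ] k<W ψh≤ = ≤-neg⁺ (begin
        count kept? (ψ h) + suc k             ≡⟨ +-comm _ (suc k) ⟩
        suc k + count kept? (ψ h)
          ≤⟨ +-monoʳ-≤ (suc k) (count-mono kept? (m+n≤o⇒m≤o∸n (ψ h) (≤-neg⁻ {b = ψ t} ψh≤))) ⟩
        suc k + count kept? (ψ t ∸ suc k)     ≤⟨ count-full kept? (suc k) (ψ t ∸ suc k) kept ⟩
        count kept? (suc k + (ψ t ∸ suc k))   ≡⟨ cong (count kept?) split ⟩
        count kept? (ψ t)                     ∎)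
        where
        open ≤-Reasoning
        split : suc k + (ψ t ∸ suc k) ≡ ψ t
        split = m+[n∸m]≡n (m+n≤o⇒n≤o (ψ h) (≤-neg⁻ {b = ψ t} ψh≤))
        kept : ∀ {i} → ψ t ∸ suc k ≤ i → i < suc k + (ψ t ∸ suc k) → Covered (map ψ xs) i
        kept {i} lo hi = Any.map⁺ (lose (complete t) (subst (i <_) split hi , (begin
          ψ t                      ≡⟨ split ⟨
          suc k + (ψ t ∸ suc k)    ≤⟨ +-mono-≤ k<W lo ⟩
          W + i                    ≡⟨ +-comm W i ⟩
          i + W                    ∎)))

    -- Values may be bounded by |X| times the sum of the absolute weights, so a
    -- schedule that cannot fail to exist is found by search.
    intConsistent-stable : ∀ (as : List IntArc) →
      ¬ ¬ (∃ λ ψ → All (IntSatisfies ψ) as) → ∃ λ ψ → All (IntSatisfies ψ) as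
    intConsistent-stable as ¬¬sol = let v , sat = decidable-stable search (¬¬-map bounded ¬¬sol) in fromVec v , sat
      where
      W B : ℕ
      W = sum (map (λ (_ , k) → ∣ k ∣) (concatMap proj₂ as))
      B = length xs * W

      weights-≤ : All (λ (_ , hs) → All (λ (_ , k) → ∣ k ∣ ≤ W) hs) as
      weights-≤ = All.map⁻ (All.concat⁻ {xss = map proj₂ as} (All.map⁻ (all-≤-sum _)))

      -- Candidates are indexed by positions in `xs`, which makes them a finite type; each `x` reads
      -- the position that `complete x` points to.
      fromVec : Vec (Fin (suc B)) (length xs) → X → ℕ
      fromVec v x = toℕ (Vec.lookup v (Any.index (complete x)))

      search : Dec (∃ λ v → All (IntSatisfies (fromVec v)) as)
      search = anyVec? (length xs) λ v → All.all? (intSatisfies? (fromVec v)) as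

      bounded : (∃ λ ψ → All (IntSatisfies ψ) as) → ∃ λ v → All (IntSatisfies (fromVec v)) as
      bounded (ψ , sat) = v , All.zipWith satisfies (weights-≤ , sat)
        where
        open Compress W ψ

        v : Vec (Fin (suc B)) (length xs)
        v = Vec.tabulate λ i → fromℕ< (s≤s (compress-≤ (List.lookup xs i)))

        fromVec-v : ∀ x → compress x ≡ fromVec v x
        fromVec-v x = sym (begin
          toℕ (Vec.lookup v i)          ≡⟨ cong toℕ (Vec.lookup∘tabulate _ i) ⟩
          toℕ (fromℕ< (s≤s (compress-≤ (List.lookup xs i)))) ≡⟨ Fin.toℕ-fromℕ< _ ⟩
          compress (List.lookup xs i)   ≡⟨ cong compress (Any.lookup-index (complete x)) ⟨
          compress x                    ∎)
          where open ≡-Reasoning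
                i = Any.index (complete x)

        satisfies : ∀ {a} → All (λ (_ , k) → ∣ k ∣ ≤ W) (proj₂ a) × IntSatisfies ψ a →
                    IntSatisfies (fromVec v) a
        satisfies {t , _} (k≤W , any) with (h , k) , i , ψh≤ ← find any =
          intSatisfies-cong fromVec-v (lose i (compress-diff h t k (All.lookup k≤W i) ψh≤))

-- Rounding a schedule to integers

-- Double negation shift over a finite list: all the ceilings may be assumed at once.
¬¬-All : ∀ {A : Set} {P : Pred A 0ℓ} → (∀ x → ¬ ¬ P x) → ∀ xs → ¬ ¬ All P xs
¬¬-All ¬¬p []       k = k []
¬¬-All ¬¬p (x ∷ xs) k = ¬¬p x λ p → ¬¬-All ¬¬p xs λ ps → k (p ∷ ps)

-- `P` need not be decidable, so only this weak least number principle is available: without a least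
-- witness, strong induction refutes every witness.
¬¬-least : ∀ {P : Pred ℕ 0ℓ} {k} → P k → ¬ ¬ (∃ λ m → P m × ∀ {j} → P j → m ≤ j)
¬¬-least {P} p none = <-rec (λ k → ¬ P k)
  (λ k below p → none (k , p , λ {j} q → ≮⇒≥ λ j<k → below j<k q)) _ p

module _ {X : Set} where

  sumℤ : (X → ℤ) → List X → ℤ
  sumℤ f = foldr (λ x z → f x ℤ.+ z) 0ℤ

  sumℤ-mono : ∀ {f g : X → ℤ} w → (∀ x → f x ℤ.≤ g x ℤ.+ w) →
              ∀ xs → sumℤ f xs ℤ.≤ sumℤ g xs ℤ.+ w ℤ.* + length xs
  sumℤ-mono w f≤g [] = ℤ.≤-reflexive (sym (trans (ℤ.+-identityˡ _) (ℤ.*-zeroʳ w)))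
  sumℤ-mono {f} {g} w f≤g (x ∷ xs) = begin
    f x ℤ.+ sumℤ f xs
      ≤⟨ ℤ.+-mono-≤ (f≤g x) (sumℤ-mono {f} {g} w f≤g xs) ⟩
    g x ℤ.+ w ℤ.+ (sumℤ g xs ℤ.+ w ℤ.* + length xs)
      ≡⟨ solve 4 (λ a w s n → a :+ w :+ (s :+ w :* n) := (a :+ s) :+ w :* (con (+ 1) :+ n)) refl (g x) w (sumℤ g xs) (+ length xs) ⟩
    (g x ℤ.+ sumℤ g xs) ℤ.+ w ℤ.* (+ 1 ℤ.+ + length xs)      ∎
    where open ℤ.≤-Reasoning
          open ℤ-Solver

  sumℤ-mono-≤ : ∀ {f g : X → ℤ} → (∀ x → f x ℤ.≤ g x) → ∀ xs → sumℤ f xs ℤ.≤ sumℤ g xs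
  sumℤ-mono-≤ f≤g []       = ℤ.≤-refl
  sumℤ-mono-≤ f≤g (x ∷ xs) = ℤ.+-mono-≤ (f≤g x) (sumℤ-mono-≤ f≤g xs)

  sumℤ-mono-< : ∀ {f g : X → ℤ} → (∀ x → f x ℤ.≤ g x) → ∀ {y} → f y ℤ.< g y →
                ∀ {xs} → y ∈ xs → sumℤ f xs ℤ.< sumℤ g xs
  sumℤ-mono-< f≤g fy<gy {_ ∷ xs} (here refl) = ℤ.+-mono-<-≤ fy<gy (sumℤ-mono-≤ f≤g xs)
  sumℤ-mono-< f≤g fy<gy {x ∷ _}  (there y∈)  = ℤ.+-mono-≤-< (f≤g x) (sumℤ-mono-< f≤g fy<gy y∈)

-- D a b w reads: a ≤ b + w.
record IsRounding {X : Set} (D : X → X → ℤ → Set) (n : ℕ) (ψ : X → ℕ) : Set where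
  field
    diff   : ∀ {a b w} → D a b w → + ψ a ℤ.≤ + ψ b ℤ.+ w ℤ.* + n
    strict : ∀ {a b} → D a b 0ℤ → ¬ D b a 0ℤ → + ψ a ℤ.< + ψ b

module Rounding {X : Set} {xs : List X} (complete : ∀ x → x ∈ xs)
  (D : X → X → ℤ → Set)
  (D-refl   : ∀ a → D a a 0ℤ)
  (D-trans  : ∀ {a b c w z} → D a b w → D b c z → D a c (w ℤ.+ z))
  (D-mono   : ∀ {a b w z} → w ℤ.≤ z → D a b w → D a b z)
  (D-nonneg : ∀ {a z} → D a a z → 0ℤ ℤ.≤ z)
  (D-arch   : ∀ a b → ∃ (D a b))
  where

  IsLeast : X → X → ℤ → Set
  IsLeast a b c = D a b c × ∀ {z} → D a b z → c ℤ.≤ z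

  -- The integers `z` with `D a b z` are bounded below: given `D b a m`, transitivity yields
  -- `D a a (z + m)`, hence `z + m ≥ 0`. Shifted by `m`, they form an inhabited set of naturals.
  least : ∀ a b → ¬ ¬ ∃ (IsLeast a b)
  least a b = ¬¬-map shift (¬¬-least {k = offset (proj₂ (D-arch a b))} (at-offset (proj₂ (D-arch a b))))
    where
    m : ℤ
    m = proj₁ (D-arch b a)

    offset : ∀ {z} → D a b z → ℕ
    offset {z} _ = ∣ z ℤ.+ m ∣

    restore : ∀ {z} (d : D a b z) → + offset d ℤ.- m ≡ z
    restore {z} d = trans
      (cong (ℤ._- m) (ℤ.0≤i⇒+∣i∣≡i (D-nonneg (D-trans d (proj₂ (D-arch b a))))))
      (solve 2 (λ z m → (z :+ m) :- m := z) refl z m)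
      where open ℤ-Solver

    at-offset : ∀ {z} (d : D a b z) → D a b (+ offset d ℤ.- m)
    at-offset d = subst (D a b) (sym (restore d)) d

    shift : (∃ λ k → D a b (+ k ℤ.- m) × ∀ {j} → D a b (+ j ℤ.- m) → k ≤ j) → ∃ (IsLeast a b)
    shift (k , d , k≤) = + k ℤ.- m , d , λ d′ → subst (+ k ℤ.- m ℤ.≤_) (restore d′)
      (ℤ.+-monoˡ-≤ (ℤ.- m) (ℤ.+≤+ (k≤ (at-offset d′))))

  -- If the least c with D a b c is the ceiling of φ a - φ b, then ψ a is, up to
  -- a constant, the sum over all b of these ceilings.
  rounding : ¬ ¬ ∃ (IsRounding D (length xs))
  rounding = ¬¬-map round (¬¬-All (λ a → ¬¬-All (least a) xs) xs)
    where
    round : All (λ a → All (λ b → ∃ (IsLeast a b)) xs) xs → ∃ (IsRounding D (length xs))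
    round table = ψ , record { diff = diff ; strict = strict }
      where
      entry : ∀ a b → ∃ (IsLeast a b)
      entry a b = All.lookup (All.lookup table (complete a)) (complete b)

      c : X → X → ℤ
      c a b = proj₁ (entry a b)

      -- Transitivity through `b` makes `w + c b x` a bound for the pair `a`, `x`, and `c a x` is
      -- the least such bound.
      c-diff : ∀ {a b w} → D a b w → ∀ x → c a x ℤ.≤ c b x ℤ.+ w
      c-diff {a} {b} {w} d x = subst (c a x ℤ.≤_) (ℤ.+-comm w (c b x))
        (proj₂ (proj₂ (entry a x)) (D-trans d (proj₁ (proj₂ (entry b x)))))

      c-mono : ∀ {a b} → D a b 0ℤ → ∀ x → c a x ℤ.≤ c b x
      c-mono d x = subst (_ ℤ.≤_) (ℤ.+-identityʳ _) (c-diff d x)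

      total : X → ℤ
      total a = sumℤ (c a) xs

      -- A common shift that makes every total nonnegative, so that the absolute value in `ψ`
      -- changes only the type.
      B : ℕ
      B = sum (map (λ a → ∣ total a ∣) xs)

      ψ : X → ℕ
      ψ a = ∣ total a ℤ.+ + B ∣

      ψ-total : ∀ a → + ψ a ≡ total a ℤ.+ + B
      ψ-total a = ℤ.0≤i⇒+∣i∣≡i (ℤ.≤-trans (ℤ.≤-reflexive (sym (ℤ.+-inverseʳ (total a))))
        (ℤ.+-monoʳ-≤ (total a) (ℤ.≤-trans (-i≤∣i∣ (total a))
          (ℤ.+≤+ (All.lookup (all-≤-sum _) (∈-map⁺ _ (complete a)))))))
        where
        -i≤∣i∣ : ∀ i → ℤ.- i ℤ.≤ + ∣ i ∣
        -i≤∣i∣ (+ zero)   = ℤ.≤-refl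
        -i≤∣i∣ (+ suc n)  = ℤ.-≤+
        -i≤∣i∣ -[1+ n ]   = ℤ.≤-refl

      diff : ∀ {a b w} → D a b w → + ψ a ℤ.≤ + ψ b ℤ.+ w ℤ.* + length xs
      diff {a} {b} {w} d = begin
        + ψ a                                        ≡⟨ ψ-total a ⟩
        total a ℤ.+ + B
          ≤⟨ ℤ.+-monoˡ-≤ (+ B) (sumℤ-mono {f = c a} {c b} w (c-diff d) xs) ⟩
        total b ℤ.+ w ℤ.* + length xs ℤ.+ + B
          ≡⟨ solve 3 (λ t k B → t :+ k :+ B := t :+ B :+ k) refl (total b) (w ℤ.* + length xs) (+ B) ⟩
        total b ℤ.+ + B ℤ.+ w ℤ.* + length xs        ≡⟨ cong (ℤ._+ w ℤ.* + length xs) (ψ-total b) ⟨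
        + ψ b ℤ.+ w ℤ.* + length xs                  ∎
        where open ℤ.≤-Reasoning
              open ℤ-Solver

      strict : ∀ {a b} → D a b 0ℤ → ¬ D b a 0ℤ → + ψ a ℤ.< + ψ b
      strict {a} {b} d ¬d = subst₂ ℤ._<_ (sym (ψ-total a)) (sym (ψ-total b))
        (ℤ.+-monoˡ-< (+ B) (sumℤ-mono-< (c-mono d) c-< (complete a)))
        where
        -- The summand at `a` separates the totals: `c a a ≤ 0` by reflexivity, whereas `c b a ≤ 0`
        -- would give `D b a 0ℤ`.
        c-< : c a a ℤ.< c b a
        c-< = ℤ.≰⇒> λ cba≤caa → ¬d (D-mono
          (ℤ.≤-trans cba≤caa (proj₂ (proj₂ (entry a a)) (D-refl a)))
          (proj₁ (proj₂ (entry b a))))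

-- Rationals and reals

module _ (m : ℕ) where

  toℚᵘ-/ : ∀ i → toℚᵘ (i / suc m) ℚᵘ.≃ mkℚᵘ i m
  toℚᵘ-/ i = ℚ.toℚᵘ-fromℚᵘ (mkℚᵘ i m)

  /-+ : ∀ i j → i / suc m ℚ.+ j / suc m ≡ (i ℤ.+ j) / suc m
  /-+ i j = ℚ.toℚᵘ-injective (begin
    toℚᵘ (i / suc m ℚ.+ j / suc m)             ≈⟨ ℚ.toℚᵘ-homo-+ (i / suc m) (j / suc m) ⟩
    toℚᵘ (i / suc m) ℚᵘ.+ toℚᵘ (j / suc m)     ≈⟨ ℚᵘ.+-cong (toℚᵘ-/ i) (toℚᵘ-/ j) ⟩
    mkℚᵘ i m ℚᵘ.+ mkℚᵘ j m
      ≈⟨ *≡* (solve 3 (λ i j n → (i :* n :+ j :* n) :* n := (i :+ j) :* (n :* n)) refl i j (+ suc m)) ⟩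
    mkℚᵘ (i ℤ.+ j) m                           ≈⟨ toℚᵘ-/ (i ℤ.+ j) ⟨
    toℚᵘ ((i ℤ.+ j) / suc m)                   ∎)
    where open ℚᵘ.≃-Reasoning
          open ℤ-Solver

  /-mono-≤ : ∀ {i j} → i ℤ.≤ j → i / suc m ℚ.≤ j / suc m
  /-mono-≤ {i} {j} i≤j = ℚ.toℚᵘ-cancel-≤ (begin
    toℚᵘ (i / suc m)   ≃⟨ toℚᵘ-/ i ⟩
    mkℚᵘ i m           ≤⟨ *≤* (ℤ.*-monoʳ-≤-nonNeg (+ suc m) i≤j) ⟩
    mkℚᵘ j m           ≃⟨ toℚᵘ-/ j ⟨
    toℚᵘ (j / suc m)   ∎)
    where open ℚᵘ.≤-Reasoning

  /-mono-< : ∀ {i j} → i ℤ.< j → i / suc m ℚ.< j / suc m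
  /-mono-< {i} {j} i<j = ℚ.toℚᵘ-cancel-< (begin-strict
    toℚᵘ (i / suc m)   ≃⟨ toℚᵘ-/ i ⟩
    mkℚᵘ i m           <⟨ *<* (ℤ.*-monoʳ-<-pos (+ suc m) i<j) ⟩
    mkℚᵘ j m           ≃⟨ toℚᵘ-/ j ⟨
    toℚᵘ (j / suc m)   ∎)
    where open ℚᵘ.≤-Reasoning

  /-zero : 0ℤ / suc m ≡ 0ℚ
  /-zero = ℚ.toℚᵘ-injective (ℚᵘ.≃-trans (toℚᵘ-/ 0ℤ) (*≡* refl))

  /-neg : ∀ i → ℚ.- (i / suc m) ≡ (ℤ.- i) / suc m
  /-neg i = begin
    ℚ.- (i / suc m)                                        ≡⟨ ℚ.+-identityʳ _ ⟨
    ℚ.- (i / suc m) ℚ.+ 0ℚ                                 ≡⟨ cong (ℚ.- (i / suc m) ℚ.+_) /-zero ⟨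
    ℚ.- (i / suc m) ℚ.+ 0ℤ / suc m
      ≡⟨ cong (λ z → ℚ.- (i / suc m) ℚ.+ z / suc m) (ℤ.+-inverseʳ i) ⟨
    ℚ.- (i / suc m) ℚ.+ (i ℤ.- i) / suc m
      ≡⟨ cong (ℚ.- (i / suc m) ℚ.+_) (/-+ i (ℤ.- i)) ⟨
    ℚ.- (i / suc m) ℚ.+ (i / suc m ℚ.+ (ℤ.- i) / suc m)
      ≡⟨ solve 2 (λ p q → (:- p) :+ (p :+ q) := q) refl (i / suc m) ((ℤ.- i) / suc m) ⟩
    (ℤ.- i) / suc m                                        ∎
    where open ≡-Reasoning
          open ℚ-Solver

  /-scale : ∀ z → z / 1 ≡ (z ℤ.* + suc m) / suc m
  /-scale z = ℚ.toℚᵘ-injective (begin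
    toℚᵘ (z / 1)                     ≈⟨ ℚ.toℚᵘ-fromℚᵘ (mkℚᵘ z 0) ⟩
    mkℚᵘ z 0                         ≈⟨ *≡* (sym (ℤ.*-identityʳ _)) ⟩
    mkℚᵘ (z ℤ.* + suc m) m           ≈⟨ toℚᵘ-/ (z ℤ.* + suc m) ⟨
    toℚᵘ ((z ℤ.* + suc m) / suc m)   ∎)
    where open ℚᵘ.≃-Reasoning

-- The denominator is at least 1, so the absolute numerator is a crude integer upper bound.
ceiling-bound : ∀ q → q ℚ.≤ (+ ∣ ℚ.↥ q ∣) / 1
ceiling-bound q@(ℚ.mkℚ n d _) = ℚ.toℚᵘ-cancel-≤ (ℚᵘ.≤-respʳ-≃ (ℚᵘ.≃-sym (toℚᵘ-/ 0 (+ ∣ n ∣))) (*≤* (begin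
    n ℤ.* + 1             ≡⟨ ℤ.*-identityʳ n ⟩
    n                     ≤⟨ i≤∣i∣ n ⟩
    + ∣ n ∣               ≤⟨ ℤ.+≤+ (m≤m*n ∣ n ∣ (suc d)) ⟩
    + (∣ n ∣ ℕ.* suc d)   ≡⟨ ℤ.pos-* ∣ n ∣ (suc d) ⟩
    + ∣ n ∣ ℤ.* + suc d   ∎)))
    where
    open ℤ.≤-Reasoning
    i≤∣i∣ : ∀ i → i ℤ.≤ + ∣ i ∣
    i≤∣i∣ (+ _)    = ℤ.≤-refl
    i≤∣i∣ -[1+ _ ] = ℤ.-≤+

Eventually : (ℕ → Set) → Set
Eventually P = ∃ λ N → ∀ n → N ℕ.≤ n → P n

eventually₂ : ∀ {P Q R : ℕ → Set} → (∀ {n} → P n → Q n → R n) →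
              Eventually P → Eventually Q → Eventually R
eventually₂ f (M , p) (N , q) = M ℕ.⊔ N , λ n le →
  f (p n (m⊔n≤o⇒m≤o M N le)) (q n (m⊔n≤o⇒n≤o M N le))

module _ {p q r : ℚ} {ε : ℚ} where
  open ℚ-Solver

  private
    h : ℚ
    h = ½ ℚ.* ε

  ≤-halves : p ℚ.≤ q ℚ.+ h → q ℚ.≤ r ℚ.+ h → p ℚ.≤ r ℚ.+ ε
  ≤-halves p≤ q≤ = begin
    p                 ≤⟨ p≤ ⟩
    q ℚ.+ h           ≤⟨ ℚ.+-monoˡ-≤ h q≤ ⟩
    r ℚ.+ h ℚ.+ h     ≡⟨ ℚ.+-assoc r h h ⟩
    r ℚ.+ (h ℚ.+ h)   ≡⟨ cong (r ℚ.+_) (halves ε) ⟩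
    r ℚ.+ ε           ∎
    where open ℚ.≤-Reasoning

  ≤-less-half : p ℚ.+ ε ℚ.≤ q → q ℚ.≤ r ℚ.+ h → p ℚ.+ h ℚ.≤ r
  ≤-less-half p≤ q≤ = subst₂ ℚ._≤_
    (trans (cong (λ e → p ℚ.+ e ℚ.- h) (sym (halves ε)))
           (solve 2 (λ p h → p :+ (h :+ h) :- h := p :+ h) refl p h))
    (solve 2 (λ r h → r :+ h :- h := r) refl r h)
    (ℚ.+-monoˡ-≤ (ℚ.- h) (ℚ.≤-trans p≤ q≤))

  ≤-half-less : p ℚ.≤ q ℚ.+ h → q ℚ.+ ε ℚ.≤ r → p ℚ.+ h ℚ.≤ r
  ≤-half-less p≤ q≤ = begin
    p ℚ.+ h           ≤⟨ ℚ.+-monoˡ-≤ h p≤ ⟩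
    q ℚ.+ h ℚ.+ h     ≡⟨ ℚ.+-assoc q h h ⟩
    q ℚ.+ (h ℚ.+ h)   ≡⟨ cong (q ℚ.+_) (halves ε) ⟩
    q ℚ.+ ε           ≤⟨ q≤ ⟩
    r                 ∎
    where open ℚ.≤-Reasoning

p≤p+ε : ∀ p {ε} → 0ℚ ℚ.< ε → p ℚ.≤ p ℚ.+ ε
p≤p+ε p 0<ε = subst (ℚ._≤ p ℚ.+ _) (ℚ.+-identityʳ p) (ℚ.+-monoʳ-≤ p (ℚ.<⇒≤ 0<ε))

≤ℝ-pointwise : ∀ {x y} → (∀ n → seq x n ℚ.≤ seq y n) → x ≤ℝ y
≤ℝ-pointwise {x} {y} x≤y ε 0<ε = 0 , λ n _ → ℚ.≤-trans (x≤y n) (p≤p+ε (seq y n) 0<ε)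

≤ℝ-trans : ∀ {x y z} → x ≤ℝ y → y ≤ℝ z → x ≤ℝ z
≤ℝ-trans {x} {y} {z} x≤y y≤z ε 0<ε =
  eventually₂ (λ {n} → ≤-halves {seq x n} {seq y n} {seq z n})
    (x≤y (½ ℚ.* ε) (half-pos 0<ε)) (y≤z (½ ℚ.* ε) (half-pos 0<ε))

<ℝ-≤ℝ-trans : ∀ {x y z} → x <ℝ y → y ≤ℝ z → x <ℝ z
<ℝ-≤ℝ-trans {x} {y} {z} (ε , 0<ε , x<y) y≤z = ½ ℚ.* ε , half-pos 0<ε ,
  eventually₂ (λ {n} → ≤-less-half {seq x n} {seq y n} {seq z n}) x<y (y≤z (½ ℚ.* ε) (half-pos 0<ε))

≤ℝ-<ℝ-trans : ∀ {x y z} → x ≤ℝ y → y <ℝ z → x <ℝ z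
≤ℝ-<ℝ-trans {x} {y} {z} x≤y (ε , 0<ε , y<z) = ½ ℚ.* ε , half-pos 0<ε ,
  eventually₂ (λ {n} → ≤-half-less {seq x n} {seq y n} {seq z n}) (x≤y (½ ℚ.* ε) (half-pos 0<ε)) y<z

<ℝ⇒≤ℝ : ∀ {x y} → x <ℝ y → x ≤ℝ y
<ℝ⇒≤ℝ {x} {y} (ε , 0<ε , N , x<y) δ 0<δ = N , λ n N≤n →
  ℚ.≤-trans (p≤p+ε (seq x n) 0<ε) (ℚ.≤-trans (x<y n N≤n) (p≤p+ε (seq y n) 0<δ))

<ℝ-irrefl : ∀ {x} → ¬ x <ℝ x
<ℝ-irrefl {x} (ε , 0<ε , N , x<x) = ℚ.<-irrefl refl (ℚ.<-≤-trans 0<ε (subst₂ ℚ._≤_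
  (solve 2 (λ p e → (:- p) :+ (p :+ e) := e) refl (seq x N) ε) (ℚ.+-inverseˡ (seq x N))
  (ℚ.+-monoʳ-≤ (ℚ.- seq x N) (x<x N ≤-refl))))
  where open ℚ-Solver

<ℝ⇒≱ℝ : ∀ {x y} → x <ℝ y → ¬ y ≤ℝ x
<ℝ⇒≱ℝ {x} {y} x<y y≤x = <ℝ-irrefl {x} (<ℝ-≤ℝ-trans {x} {y} {x} x<y y≤x)

-- One rational comparison, at an index `N` beyond which both sequences move by at most `δ`, settles
-- the matter. If `y` leads by more than `2δ` there, the excess persists and gives `x <ℝ y`.
-- Otherwise the allowance `2δ` and a drift of `δ` in each sequence add up to `4δ = ε`.
≮ℝ⇒≥ℝ : ∀ {x y} → ¬ x <ℝ y → y ≤ℝ x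
≮ℝ⇒≥ℝ {x} {y} x≮y ε 0<ε = compare
  where
  open ℚ-Solver
  δ : ℚ
  δ = ½ ℚ.* (½ ℚ.* ε)

  0<δ : 0ℚ ℚ.< δ
  0<δ = half-pos (half-pos 0<ε)

  4δ : δ ℚ.+ δ ℚ.+ (δ ℚ.+ δ) ≡ ε
  4δ = trans (cong (λ p → p ℚ.+ p) (halves (½ ℚ.* ε))) (halves ε)

  N : ℕ
  N = proj₁ (cauchy x δ 0<δ) ℕ.⊔ proj₁ (cauchy y δ 0<δ)

  near : ∀ z m → (∀ i j → m ℕ.≤ i → m ℕ.≤ j → ℚ.∣ seq z i ℚ.- seq z j ∣ ℚ.≤ δ) →
         ∀ i j → m ℕ.≤ i → m ℕ.≤ j → seq z i ℚ.≤ seq z j ℚ.+ δ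
  near z m c i j m≤i m≤j = ∣-∣-upper {seq z i} (c i j m≤i m≤j)

  nearx : ∀ i j → N ℕ.≤ i → N ℕ.≤ j → seq x i ℚ.≤ seq x j ℚ.+ δ
  nearx i j N≤i N≤j = near x _ (proj₂ (cauchy x δ 0<δ)) i j
    (m⊔n≤o⇒m≤o _ _ N≤i) (m⊔n≤o⇒m≤o _ _ N≤j)

  neary : ∀ i j → N ℕ.≤ i → N ℕ.≤ j → seq y i ℚ.≤ seq y j ℚ.+ δ
  neary i j N≤i N≤j = near y _ (proj₂ (cauchy y δ 0<δ)) i j
    (m⊔n≤o⇒n≤o (proj₁ (cauchy x δ 0<δ)) _ N≤i) (m⊔n≤o⇒n≤o (proj₁ (cauchy x δ 0<δ)) _ N≤j)

  compare : Eventually λ n → seq y n ℚ.≤ seq x n ℚ.+ ε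
  compare with seq y N ℚ.≤? seq x N ℚ.+ (δ ℚ.+ δ)
  ... | yes close = N , λ n N≤n → begin
    seq y n                                        ≤⟨ neary n N N≤n ≤-refl ⟩
    seq y N ℚ.+ δ                                  ≤⟨ ℚ.+-monoˡ-≤ δ close ⟩
    seq x N ℚ.+ (δ ℚ.+ δ) ℚ.+ δ
      ≤⟨ ℚ.+-monoˡ-≤ δ (ℚ.+-monoˡ-≤ (δ ℚ.+ δ) (nearx N n ≤-refl N≤n)) ⟩
    seq x n ℚ.+ δ ℚ.+ (δ ℚ.+ δ) ℚ.+ δ
      ≡⟨ solve 2 (λ p d → p :+ d :+ (d :+ d) :+ d := p :+ (d :+ d :+ (d :+ d))) refl (seq x n) δ ⟩
    seq x n ℚ.+ (δ ℚ.+ δ ℚ.+ (δ ℚ.+ δ))            ≡⟨ cong (seq x n ℚ.+_) 4δ ⟩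
    seq x n ℚ.+ ε                                  ∎
    where open ℚ.≤-Reasoning
  ... | no far = contradiction (gap , 0<gap , N , λ n N≤n → apart n N≤n) x≮y
    where
    gap : ℚ
    gap = seq y N ℚ.- (seq x N ℚ.+ (δ ℚ.+ δ))

    0<gap : 0ℚ ℚ.< gap
    0<gap = subst (ℚ._< gap) (ℚ.+-inverseʳ (seq x N ℚ.+ (δ ℚ.+ δ)))
      (ℚ.+-monoˡ-< (ℚ.- (seq x N ℚ.+ (δ ℚ.+ δ))) (ℚ.≰⇒> far))

    apart : ∀ n → N ℕ.≤ n → seq x n ℚ.+ gap ℚ.≤ seq y n
    apart n N≤n = begin
      seq x n ℚ.+ gap
        ≤⟨ ℚ.+-mono-≤ (nearx n N N≤n ≤-refl) (ℚ.+-monoˡ-≤ _ (neary N n ≤-refl N≤n)) ⟩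
      seq x N ℚ.+ δ ℚ.+ (seq y n ℚ.+ δ ℚ.- (seq x N ℚ.+ (δ ℚ.+ δ)))
                                    ≡⟨ solve 3 (λ x y d → x :+ d :+ (y :+ d :- (x :+ (d :+ d))) := y) refl (seq x N) (seq y n) δ ⟩
      seq y n                       ∎
      where open ℚ.≤-Reasoning

≃ℝ⇒≥ℝ : ∀ {x y} → x ≃ℝ y → y ≤ℝ x
≃ℝ⇒≥ℝ {x} {y} x≃y ε 0<ε = let N , h = x≃y ε 0<ε in
  N , λ n N≤n → ∣-∣-upper {seq y n} (subst (ℚ._≤ ε) (swap-∣-∣ (seq x n) (seq y n)) (h n N≤n))

≤ℝ-antisym : ∀ {x y} → x ≤ℝ y → y ≤ℝ x → x ≃ℝ y
≤ℝ-antisym {x} {y} x≤y y≤x ε 0<ε =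
  eventually₂ (λ {n} → ∣-∣-bound {seq x n}) (x≤y ε 0<ε) (y≤x ε 0<ε)

-ℝ-monoˡ-≤ : ∀ {x y} w → x ≤ℝ y → x -ℝ w ≤ℝ y -ℝ w
-ℝ-monoˡ-≤ {x} {y} w x≤y ε 0<ε = let N , h = x≤y ε 0<ε in N , λ n N≤n →
  subst (seq x n ℚ.- seq w n ℚ.≤_)
    (solve 3 (λ y e w → y :+ e :- w := y :- w :+ e) refl (seq y n) ε (seq w n))
    (ℚ.+-monoˡ-≤ (ℚ.- seq w n) (h n N≤n))
  where open ℚ-Solver

x-0≤x : ∀ x → x -ℝ 0ℝ ≤ℝ x
x-0≤x x = ≤ℝ-pointwise {x -ℝ 0ℝ} {x} λ n → ℚ.≤-reflexive (ℚ.+-identityʳ (seq x n))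

x≤x-0 : ∀ x → x ≤ℝ x -ℝ 0ℝ
x≤x-0 x = ≤ℝ-pointwise {x} {x -ℝ 0ℝ} λ n → ℚ.≤-reflexive (sym (ℚ.+-identityʳ (seq x n)))

x<x+pos : ∀ x {y} → 0ℝ <ℝ y → x <ℝ x -ℝ (-ℝ y)
x<x+pos x {y} (ε , 0<ε , N , 0<y) = ε , 0<ε , N , λ n N≤n → ℚ.+-monoʳ-≤ (seq x n)
  (subst₂ ℚ._≤_ (ℚ.+-identityˡ ε) (solve 1 (λ y → y := :- (:- y)) refl (seq y n)) (0<y n N≤n))
  where open ℚ-Solver

-fromℤ-trans : ∀ {x y u} w z → x -ℝ fromℤ w ≤ℝ y → y -ℝ fromℤ z ≤ℝ u → x -ℝ fromℤ (w ℤ.+ z) ≤ℝ u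
-fromℤ-trans {x} {y} {u} w z x≤y y≤u = ≤ℝ-trans {x -ℝ fromℤ (w ℤ.+ z)} {x -ℝ fromℤ w -ℝ fromℤ z} {u}
  (≤ℝ-pointwise {x -ℝ fromℤ (w ℤ.+ z)} {x -ℝ fromℤ w -ℝ fromℤ z} λ n → ℚ.≤-reflexive
    (trans (cong (λ q → seq x n ℚ.- q) (sym (/-+ 0 w z)))
      (solve 3 (λ x w z → x :- (w :+ z) := x :- w :- z) refl (seq x n) (w / 1) (z / 1))))
  (≤ℝ-trans {x -ℝ fromℤ w -ℝ fromℤ z} {y -ℝ fromℤ z} {u} (-ℝ-monoˡ-≤ {x -ℝ fromℤ w} {y} (fromℤ z) x≤y) y≤u)
  where open ℚ-Solver

-fromℤ-mono : ∀ {x y w z} → w ℤ.≤ z → x -ℝ fromℤ w ≤ℝ y → x -ℝ fromℤ z ≤ℝ y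
-fromℤ-mono {x} {y} {w} {z} w≤z = ≤ℝ-trans {x -ℝ fromℤ z} {x -ℝ fromℤ w} {y}
  (≤ℝ-pointwise {x -ℝ fromℤ z} {x -ℝ fromℤ w} λ n →
    ℚ.+-monoʳ-≤ (seq x n) (ℚ.neg-antimono-≤ (/-mono-≤ 0 w≤z)))

x<x-neg : ∀ x {z} → z ℤ.< 0ℤ → x <ℝ x -ℝ fromℤ z
x<x-neg x {z} z<0 = ℚ.- (z / 1) , ℚ.neg-antimono-< (/-mono-< 0 z<0) , 0 , λ n _ → ℚ.≤-refl

-fromℤ-nonneg : ∀ {x z} → x -ℝ fromℤ z ≤ℝ x → 0ℤ ℤ.≤ z
-fromℤ-nonneg {x} {z} x-z≤x = ℤ.≮⇒≥ λ z<0 →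
  <ℝ⇒≱ℝ {x} {x -ℝ fromℤ z} (x<x-neg x z<0) x-z≤x

-fromℤ-arch : ∀ x y → ∃ λ z → x -ℝ fromℤ z ≤ℝ y
-fromℤ-arch x y with M , cx ← cauchy x 1ℚ (ℚ.positive⁻¹ 1ℚ) | N , cy ← cauchy y 1ℚ (ℚ.positive⁻¹ 1ℚ) = z , λ ε 0<ε →
  K , λ n K≤n → ℚ.≤-trans (below n K≤n) (p≤p+ε (seq y n) 0<ε)
  where
  open ℚ-Solver
  K : ℕ
  K = M ℕ.⊔ N
  q : ℚ
  -- From `K` on, `x` stays below `seq x K + 1` and `y` above `seq y K - 1`; any integer not below
  -- this difference will do.
  q = seq x K ℚ.+ 1ℚ ℚ.- (seq y K ℚ.- 1ℚ)
  z : ℤ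
  z = + ∣ ℚ.↥ q ∣
  M≤ : ∀ {n} → K ℕ.≤ n → M ℕ.≤ n
  M≤ = m⊔n≤o⇒m≤o M N
  N≤ : ∀ {n} → K ℕ.≤ n → N ℕ.≤ n
  N≤ = m⊔n≤o⇒n≤o M N
  below : ∀ n → K ℕ.≤ n → seq x n ℚ.- z / 1 ℚ.≤ seq y n
  below n K≤n = begin
    seq x n ℚ.- z / 1
      ≤⟨ ℚ.+-mono-≤ (∣-∣-upper {seq x n} (cx n K (M≤ K≤n) (M≤ ≤-refl))) (ℚ.neg-antimono-≤ (ceiling-bound q)) ⟩
    seq x K ℚ.+ 1ℚ ℚ.- q
      ≡⟨ solve 3 (λ x y o → x :+ o :- (x :+ o :- (y :- o)) := y :- o) refl (seq x K) (seq y K) 1ℚ ⟩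
    seq y K ℚ.- 1ℚ
      ≤⟨ ℚ.+-monoˡ-≤ (ℚ.- 1ℚ) (∣-∣-upper {seq y K} (cy K n (N≤ ≤-refl) (N≤ K≤n))) ⟩
    seq y n ℚ.+ 1ℚ ℚ.- 1ℚ              ≡⟨ solve 2 (λ y o → y :+ o :- o := y) refl (seq y n) 1ℚ ⟩
    seq y n                            ∎
    where open ℚ.≤-Reasoning

⊓ℝ-≤ˡ : ∀ x y → x ⊓ℝ y ≤ℝ x
⊓ℝ-≤ˡ x y = ≤ℝ-pointwise {x ⊓ℝ y} {x} λ n → ℚ.p⊓q≤p (seq x n) (seq y n)

⊓ℝ-≤ʳ : ∀ x y → x ⊓ℝ y ≤ℝ y
⊓ℝ-≤ʳ x y = ≤ℝ-pointwise {x ⊓ℝ y} {y} λ n → ℚ.p⊓q≤q (seq x n) (seq y n)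

<ℝ-⊓ℝ : ∀ {x y z} → x <ℝ y → x <ℝ z → x <ℝ y ⊓ℝ z
<ℝ-⊓ℝ {x} {y} {z} (ε , 0<ε , x<y) (δ , 0<δ , x<z) = ε ℚ.⊓ δ , 0<ε⊓δ , eventually₂
  (λ {n} x+ε≤y x+δ≤z → ℚ.⊓-glb
    (ℚ.≤-trans (ℚ.+-monoʳ-≤ (seq x n) (ℚ.p⊓q≤p ε δ)) x+ε≤y)
    (ℚ.≤-trans (ℚ.+-monoʳ-≤ (seq x n) (ℚ.p⊓q≤q ε δ)) x+δ≤z)) x<y x<z
  where
  0<ε⊓δ : 0ℚ ℚ.< ε ℚ.⊓ δ
  0<ε⊓δ with ℚ.⊓-sel ε δ
  ... | inj₁ eq = subst (0ℚ ℚ.<_) (sym eq) 0<ε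
  ... | inj₂ eq = subst (0ℚ ℚ.<_) (sym eq) 0<δ

-- A bound on a minimum does not tell which argument obeys it; a strict inequality excluding the
-- other one does.
⊓ℝ≤⇒≤ˡ : ∀ {x y z} → x ⊓ℝ y ≤ℝ z → z <ℝ y → x ≤ℝ z
⊓ℝ≤⇒≤ˡ {x} {y} {z} x⊓y≤z z<y = ≮ℝ⇒≥ℝ {z} {x} λ z<x →
  <ℝ⇒≱ℝ {z} {x ⊓ℝ y} (<ℝ-⊓ℝ {z} {x} {y} z<x z<y) x⊓y≤z

⊓ℝ≤⇒≤ʳ : ∀ {x y z} → x ⊓ℝ y ≤ℝ z → ¬ x ≤ℝ z → y ≤ℝ z
⊓ℝ≤⇒≤ʳ {x} {y} {z} x⊓y≤z x≰z = ≮ℝ⇒≥ℝ {z} {y} λ z<y → x≰z (⊓ℝ≤⇒≤ˡ {x} {y} {z} x⊓y≤z z<y)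

minℝ-≤ : ∀ {y} x xs → Any (_≤ℝ y) (x ∷ xs) → minℝ (x ∷ xs) ≤ℝ y
minℝ-≤     x []        (here x≤y) = x≤y
minℝ-≤ {y} x (x′ ∷ xs) (here x≤y) = ≤ℝ-trans {minℝ (x ∷ x′ ∷ xs)} {x} {y} (⊓ℝ-≤ˡ x (minℝ (x′ ∷ xs))) x≤y
minℝ-≤ {y} x (x′ ∷ xs) (there i)  = ≤ℝ-trans {minℝ (x ∷ x′ ∷ xs)} {minℝ (x′ ∷ xs)} {y}
  (⊓ℝ-≤ʳ x (minℝ (x′ ∷ xs))) (minℝ-≤ {y} x′ xs i)

-- The term that obeys the bound cannot be exhibited in general, so only the refutation of all
-- failures is stated.
minℝ-attained : ∀ {y} x xs → minℝ (x ∷ xs) ≤ℝ y → ¬ All (λ x → ¬ x ≤ℝ y) (x ∷ xs)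
minℝ-attained     x []        x≤y   (x≰y ∷ [])  = x≰y x≤y
minℝ-attained {y} x (x′ ∷ xs) min≤y (x≰y ∷ all) =
  minℝ-attained {y} x′ xs (⊓ℝ≤⇒≤ʳ {x} {minℝ (x′ ∷ xs)} {y} min≤y x≰y) all

<ℝ-minℝ : ∀ {y} x xs → All (y <ℝ_) (x ∷ xs) → y <ℝ minℝ (x ∷ xs)
<ℝ-minℝ     x []        (y<x ∷ [])  = y<x
<ℝ-minℝ {y} x (x′ ∷ xs) (y<x ∷ all) = <ℝ-⊓ℝ {y} {x} {minℝ (x′ ∷ xs)} y<x (<ℝ-minℝ {y} x′ xs all)

minℝ≤⇒head≤ : ∀ {y} x xs → minℝ (x ∷ xs) ≤ℝ y → All (y <ℝ_) xs → x ≤ℝ y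
minℝ≤⇒head≤     x []        x≤y   [] = x≤y
minℝ≤⇒head≤ {y} x (x′ ∷ xs) min≤y all =
  ⊓ℝ≤⇒≤ˡ {x} {minℝ (x′ ∷ xs)} {y} min≤y (<ℝ-minℝ {y} x′ xs all)

scaled-≤ : ∀ m {a b k} (w : ℝ) → (∀ n → seq w n ≡ k / suc m) → a ℤ.≤ b ℤ.+ k →
           fromℚ (a / suc m) -ℝ w ≤ℝ fromℚ (b / suc m)
scaled-≤ m {a} {b} {k} w w≡k a≤b+k = ≤ℝ-pointwise {fromℚ (a / suc m) -ℝ w} {fromℚ (b / suc m)} λ n → begin
  a / suc m ℚ.- seq w n                         ≡⟨ cong (λ q → a / suc m ℚ.- q) (w≡k n) ⟩
  a / suc m ℚ.- k / suc m
    ≤⟨ ℚ.+-monoˡ-≤ (ℚ.- (k / suc m)) (/-mono-≤ m a≤b+k) ⟩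
  (b ℤ.+ k) / suc m ℚ.- k / suc m               ≡⟨ cong (λ q → q ℚ.- k / suc m) (/-+ m b k) ⟨
  b / suc m ℚ.+ k / suc m ℚ.- k / suc m
    ≡⟨ solve 2 (λ b k → b :+ k :- k := b) refl (b / suc m) (k / suc m) ⟩
  b / suc m                                     ∎
  where open ℚ.≤-Reasoning
        open ℚ-Solver

-- Restrictions to a scenario, and the size of ℋ

length-retain : ∀ {A : Set} (f : A → Bool) xs → length (retain f xs) ≤ length xs
length-retain f []       = z≤n
length-retain f (x ∷ xs) with T? (f x)
... | yes _ = s≤s (length-retain f xs)
... | no  _ = m≤n⇒m≤1+n (length-retain f xs)

module _ (Γ : CHyTN) where
  open CHyTN Γ

  isActive : ∀ s {A : HyperConstraint ∣V∣ ∣P∣} →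
             (∃ λ h → h ∈ toList (HyperConstraint.heads A)) → Bool
  isActive s = λ h → s ⟦ LabeledHead.label (proj₁ h) ⟧

  -- The number of heads serves the size bound, the integrality of the weights serves the rounding.
  -- Integrality speaks of the sequence alone, leaving the Cauchy proof aside.
  RestrictionOf : HyperConstraint ∣V∣ ∣P∣ → ∀ {s} → Hyperarc (V⁺ s) → Set
  RestrictionOf A a =
    length (toList heads) ≤ length (toList (HyperConstraint.heads A)) ×
    All (λ (_ , w) → ∃ λ z → ∀ n → seq w n ≡ z / 1) (toList heads)
    where open Hyperarc a

  restrict-restrictionOf : ∀ s {A} (A∈ : A ∈ 𝒜) →
                           Maybe.All (RestrictionOf A) (restrict s A∈)
  -- Both arguments of `build` are abstracted together, because the type of the second mentions the
  -- first.
  restrict-restrictionOf s {A} A∈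
    with retain (isActive s {A}) (attach (toList (HyperConstraint.heads A))) in eq
       | retain-AllPairs (isActive s {A}) (attach-AllPairs (heads-distinct A∈))
  ... | []     | _ = nothing
  ... | h ∷ hs | _ = just (heads-≤ , All.map⁺ (All.universal integral (h ∷ hs)))
    where
    integral : ∀ h → ∃ λ z → ∀ (n : ℕ) → LabeledHead.weight (proj₁ (proj₁ h)) / 1 ≡ z / 1
    integral h = LabeledHead.weight (proj₁ (proj₁ h)) , λ _ → refl

    hsA : List (LabeledHead ∣V∣ ∣P∣)
    hsA = toList (HyperConstraint.heads A)

    heads-≤ : length (map _ (h ∷ hs)) ≤ length hsA
    heads-≤ = begin
      length (map _ (h ∷ hs))                        ≡⟨ length-map _ (h ∷ hs) ⟩
      length (h ∷ hs)                                ≡⟨ cong length eq ⟨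
      length (retain (isActive s {A}) (attach hsA))
        ≤⟨ length-retain (isActive s {A}) (attach hsA) ⟩
      length (attach hsA)
        ≡⟨ length-mapWith∈ (setoid _) hsA {λ x∈ → _ , x∈} ⟩
      length hsA                                     ∎
      where open ≤-Reasoning

  -- Meant for the constraints supplied by `WD2`: wherever the label holds their single head
  -- survives, so no minimum is left to analyse.
  restrict-standard : ∀ s {h t w ℓ} (A∈ : standard h t w ℓ ∈ 𝒜) → T (s ⟦ ℓ ⟧) →
     ∃ λ a → restrict s A∈ ≡ just a × ∃ λ t₁ → ∃ λ t₂ →
      Hyperarc.tail a ≡ (t , t₁) × Hyperarc.heads a ≡ ((h , t₂) , fromℤ w) ∷ []
  restrict-standard s {ℓ = ℓ} A∈ t with heads-distinct A∈
  ... | [] ∷ [] with T? (s ⟦ ℓ ⟧)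
  ...   | yes _ = _ , refl , _ , _ , refl , refl
  ...   | no ¬t = contradiction t ¬t

module _ {A B : Set} where

  all-catMaybes-mapWith∈ : ∀ {P : Pred B 0ℓ} (xs : List A) {f : ∀ {x} → x ∈ xs → Maybe B} →
    (∀ {x} (i : x ∈ xs) → Maybe.All P (f i)) → All P (catMaybes (mapWith∈ xs f))
  all-catMaybes-mapWith∈ []       p = []
  all-catMaybes-mapWith∈ (x ∷ xs) {f} p with f (here refl) | p (here refl)
  ... | nothing | _      = all-catMaybes-mapWith∈ xs (p ∘ there)
  ... | just y  | just q = q ∷ all-catMaybes-mapWith∈ xs (p ∘ there)

  ∈-catMaybes-mapWith∈ : ∀ {xs : List A} (f : ∀ {x} → x ∈ xs → Maybe B) {x y} (i : x ∈ xs) →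
    f i ≡ just y → y ∈ catMaybes (mapWith∈ xs f)
  ∈-catMaybes-mapWith∈ f (here refl) eq rewrite eq = here refl
  ∈-catMaybes-mapWith∈ f (there i)   eq with f (here refl)
  ... | nothing = ∈-catMaybes-mapWith∈ (f ∘ there) i eq
  ... | just _  = there (∈-catMaybes-mapWith∈ (f ∘ there) i eq)

  sum-catMaybes-mapWith∈ : ∀ (g : B → ℕ) (h : A → ℕ) xs {f : ∀ {x} → x ∈ xs → Maybe B} →
    (∀ {x} (i : x ∈ xs) → Maybe.All (λ y → g y ≤ h x) (f i)) →
    sum (map g (catMaybes (mapWith∈ xs f))) ≤ sum (map h xs)
  sum-catMaybes-mapWith∈ g h []       p = z≤n
  sum-catMaybes-mapWith∈ g h (x ∷ xs) {f} p with f (here refl) | p (here refl)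
  ... | nothing | _      = ≤-trans (sum-catMaybes-mapWith∈ g h xs (p ∘ there)) (m≤n+m _ (h x))
  ... | just y  | just q = +-mono-≤ q (sum-catMaybes-mapWith∈ g h xs (p ∘ there))

  sum-concatMap-≤ : ∀ (g : B → ℕ) (f : A → List B) k → (∀ x → sum (map g (f x)) ≤ k) →
    ∀ xs → sum (map g (concatMap f xs)) ≤ length xs * k
  sum-concatMap-≤ g f k f≤ []       = z≤n
  sum-concatMap-≤ g f k f≤ (x ∷ xs) = begin
    sum (map g (f x ++ concatMap f xs))             ≡⟨ cong sum (map-++ g (f x) (concatMap f xs)) ⟩
    sum (map g (f x) ++ map g (concatMap f xs))     ≡⟨ sum-++ (map g (f x)) _ ⟩
    sum (map g (f x)) + sum (map g (concatMap f xs))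
      ≤⟨ +-mono-≤ (f≤ x) (sum-concatMap-≤ g f k f≤ xs) ⟩
    k + length xs * k                               ∎
    where open ≤-Reasoning

  length-cartesianProduct : ∀ (xs : List A) (ys : List B) →
    length (cartesianProduct xs ys) ≡ length xs * length ys
  length-cartesianProduct []       ys = refl
  length-cartesianProduct (x ∷ xs) ys = trans (length-++ (map (x ,_) ys))
    (cong₂ _+_ (length-map (x ,_) ys) (length-cartesianProduct xs ys))

module _ {A : Set} where

  sum-map-≤ : ∀ (g : A → ℕ) k → (∀ x → g x ≤ k) → ∀ xs → sum (map g xs) ≤ length xs * k
  sum-map-≤ g k g≤ []       = z≤n
  sum-map-≤ g k g≤ (x ∷ xs) = +-mono-≤ (g≤ x) (sum-map-≤ g k g≤ xs)

  length≡sum : (xs : List A) → length xs ≡ sum (map (λ _ → 1) xs)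
  length≡sum []       = refl
  length≡sum (_ ∷ xs) = cong suc (length≡sum xs)

  length-deduplicate : ∀ (_≟_ : DecidableEquality A) xs → length (deduplicate _≟_ xs) ≤ length xs
  length-deduplicate _≟_ []       = z≤n
  length-deduplicate _≟_ (x ∷ xs) =
    s≤s (≤-trans (length-filter (¬? ∘ (x ≟_)) (deduplicate _≟_ xs)) (length-deduplicate _≟_ xs))

length-allFin : ∀ n → length (allFin n) ≡ n
length-allFin n = length-tabulate {n = n} (λ i → i)

module Counting (Γ : CHyTN) where
  open CHyTN Γ

  nodeCount-≤ : ∀ ε → HyTN.nodeCount (ℋ ε) ≤ ∣Σ-P∣ * ∣V∣
  nodeCount-≤ ε = begin
    length (retain _ (cartesianProduct (allFin ∣V∣) Σ-P))
      ≤⟨ length-retain _ (cartesianProduct (allFin ∣V∣) Σ-P) ⟩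
    length (cartesianProduct (allFin ∣V∣) Σ-P)
      ≡⟨ length-cartesianProduct (allFin ∣V∣) Σ-P ⟩
    length (allFin ∣V∣) * ∣Σ-P∣                             ≡⟨ cong (_* ∣Σ-P∣) (length-allFin ∣V∣) ⟩
    ∣V∣ * ∣Σ-P∣                                             ≡⟨ *-comm ∣V∣ ∣Σ-P∣ ⟩
    ∣Σ-P∣ * ∣V∣                                             ∎
    where open ≤-Reasoning

  -- One weighted count serves both bounds: `g` constantly 1 counts the arcs, and `g` counting the
  -- nodes of an arc gives the size.
  sum-arcs-≤ : ∀ ε (g : Hyperarc Node → ℕ) (h : HyperConstraint ∣V∣ ∣P∣ → ℕ) k →
    (∀ {A} s (a : Hyperarc (V⁺ s)) → RestrictionOf Γ A a → g (mapArc (node s) (node-injective s) a) ≤ h A) →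
    (∀ s₁ s₂ u t₁ t₂ → g (α ε s₁ s₂ u t₁ t₂) ≤ k) →
    sum (map g (HyTN.arcs (ℋ ε))) ≤ ∣Σ-P∣ * sum (map h 𝒜) + ∣Σ-P∣ * ∣Σ-P∣ * (∣V∣ * k)
  sum-arcs-≤ ε g h k scenario-≤ α-≤ = begin
    sum (map g (scenarioArcs ++ dynamicArcs ε))
      ≡⟨ cong sum (map-++ g scenarioArcs (dynamicArcs ε)) ⟩
    sum (map g scenarioArcs ++ map g (dynamicArcs ε))          ≡⟨ sum-++ (map g scenarioArcs) _ ⟩
    sum (map g scenarioArcs) + sum (map g (dynamicArcs ε))     ≤⟨ +-mono-≤ scenario dynamic ⟩
    ∣Σ-P∣ * sum (map h 𝒜) + ∣Σ-P∣ * ∣Σ-P∣ * (∣V∣ * k)          ∎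
    where
    open ≤-Reasoning
    scenario : sum (map g scenarioArcs) ≤ ∣Σ-P∣ * sum (map h 𝒜)
    scenario = sum-concatMap-≤ g _ _ (λ s → ≤-trans
      (≤-reflexive (cong sum (sym (map-∘ {g = g} {f = mapArc (node s) (node-injective s)} (𝒜⁺ s)))))
      (sum-catMaybes-mapWith∈ _ h 𝒜 λ A∈ → Maybe.map (scenario-≤ s _) (restrict-restrictionOf Γ s A∈))) Σ-P

    events : ∀ s₁ s₂ → List (∃ λ u → T (s₁ ⟦ L u ⟧ ∧ s₂ ⟦ L u ⟧))
    events s₁ s₂ = retain (λ u → s₁ ⟦ L u ⟧ ∧ s₂ ⟦ L u ⟧) (allFin ∣V∣)

    events-≤ : ∀ s₁ s₂ → length (events s₁ s₂) ≤ ∣V∣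
    events-≤ s₁ s₂ = ≤-trans (length-retain _ (allFin ∣V∣)) (≤-reflexive (length-allFin ∣V∣))

    toα : ∀ s₁ s₂ → (∃ λ u → T (s₁ ⟦ L u ⟧ ∧ s₂ ⟦ L u ⟧)) → Hyperarc Node
    toα s₁ s₂ (u , t) = let t₁ , t₂ = Equivalence.to T-∧ t in α ε s₁ s₂ u t₁ t₂

    dynamic : sum (map g (dynamicArcs ε)) ≤ ∣Σ-P∣ * ∣Σ-P∣ * (∣V∣ * k)
    dynamic = ≤-trans
      (sum-concatMap-≤ g (λ (s₁ , s₂) → map (toα s₁ s₂) (events s₁ s₂)) (∣V∣ * k) (λ (s₁ , s₂) → begin
        sum (map g (map (toα s₁ s₂) (events s₁ s₂)))
          ≡⟨ cong sum (map-∘ {g = g} {f = toα s₁ s₂} (events s₁ s₂)) ⟨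
        sum (map (g ∘ toα s₁ s₂) (events s₁ s₂))
          ≤⟨ sum-map-≤ (g ∘ toα s₁ s₂) k (λ (u , _) → α-≤ s₁ s₂ u _ _) (events s₁ s₂) ⟩
        length (events s₁ s₂) * k                      ≤⟨ *-monoˡ-≤ k (events-≤ s₁ s₂) ⟩
        ∣V∣ * k                                        ∎) (cartesianProduct Σ-P Σ-P))
      (≤-reflexive (cong (_* (∣V∣ * k)) (length-cartesianProduct Σ-P Σ-P)))

  arcCount-≤ : ∀ ε → HyTN.arcCount (ℋ ε) ≤ 1 * (∣Σ-P∣ * ∣𝒜∣ + ∣Σ-P∣ ^ 2 * ∣V∣)
  arcCount-≤ ε = begin
    HyTN.arcCount (ℋ ε)
      ≡⟨ length≡sum (HyTN.arcs (ℋ ε)) ⟩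
    sum (map (λ _ → 1) (HyTN.arcs (ℋ ε)))
      ≤⟨ sum-arcs-≤ ε (λ _ → 1) (λ _ → 1) 1 (λ _ _ _ → ≤-refl) (λ _ _ _ _ _ → ≤-refl) ⟩
    ∣Σ-P∣ * sum (map (λ _ → 1) 𝒜) + ∣Σ-P∣ * ∣Σ-P∣ * (∣V∣ * 1)
      ≡⟨ cong (λ n → ∣Σ-P∣ * n + ∣Σ-P∣ * ∣Σ-P∣ * (∣V∣ * 1)) (length≡sum 𝒜) ⟨
    ∣Σ-P∣ * ∣𝒜∣ + ∣Σ-P∣ * ∣Σ-P∣ * (∣V∣ * 1)
      ≡⟨ solve 3 (λ S A V → S :* A :+ S :* S :* (V :* con 1) := con 1 :* (S :* A :+ S :^ 2 :* V)) refl ∣Σ-P∣ ∣𝒜∣ ∣V∣ ⟩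
    1 * (∣Σ-P∣ * ∣𝒜∣ + ∣Σ-P∣ ^ 2 * ∣V∣)                                 ∎
    where open ≤-Reasoning
          open ℕ-Solver

  Δ-length : ∀ s₁ s₂ → length (Δ s₁ s₂) ≤ ∣P∣
  Δ-length s₁ s₂ = begin
    length (Δ s₁ s₂)              ≤⟨ length-retain _ (map obs differing) ⟩
    length (map obs differing)    ≡⟨ length-map obs differing ⟩
    length differing              ≤⟨ length-filter _ (allFin ∣P∣) ⟩
    length (allFin ∣P∣)           ≡⟨ length-allFin ∣P∣ ⟩
    ∣P∣                           ∎
    where
    open ≤-Reasoning
    differing : List (Fin ∣P∣)
    differing = filter (λ p → ¬? (lookup s₁ p Bool.≟ lookup s₂ p)) (allFin ∣P∣)

  size-≤ : ∀ ε → 1 ≤ ∣P∣ → HyTN.size (ℋ ε) ≤ 3 * (∣Σ-P∣ * m𝒜 + ∣Σ-P∣ ^ 2 * ∣V∣ * ∣P∣)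
  size-≤ ε 1≤P = begin
    sum (map arcSize (HyTN.arcs (ℋ ε)))
      ≤⟨ sum-arcs-≤ ε arcSize (λ A → length (toList (HyperConstraint.heads A)) + 1) (3 * ∣P∣) (λ {A} → scenario-≤ {A}) α-≤ ⟩
    ∣Σ-P∣ * m𝒜 + ∣Σ-P∣ * ∣Σ-P∣ * (∣V∣ * (3 * ∣P∣))
      ≤⟨ +-monoˡ-≤ _ (m≤m+n (∣Σ-P∣ * m𝒜) (2 * (∣Σ-P∣ * m𝒜))) ⟩
    ∣Σ-P∣ * m𝒜 + 2 * (∣Σ-P∣ * m𝒜) + ∣Σ-P∣ * ∣Σ-P∣ * (∣V∣ * (3 * ∣P∣))
      ≡⟨ solve 4 (λ S M V P → S :* M :+ con 2 :* (S :* M) :+ S :* S :* (V :* (con 3 :* P))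
                            := con 3 :* (S :* M :+ S :^ 2 :* V :* P)) refl ∣Σ-P∣ m𝒜 ∣V∣ ∣P∣ ⟩
    3 * (∣Σ-P∣ * m𝒜 + ∣Σ-P∣ ^ 2 * ∣V∣ * ∣P∣) ∎
    where
    open ≤-Reasoning
    open ℕ-Solver

    arcNodes : Hyperarc Node → List Node
    arcNodes a = Hyperarc.tail a ∷ map proj₁ (toList (Hyperarc.heads a))

    arcSize : Hyperarc Node → ℕ
    arcSize a = length (deduplicate (HyTN._≟_ (ℋ ε)) (arcNodes a))

    arcSize-≤ : ∀ a → arcSize a ≤ suc (length (toList (Hyperarc.heads a)))
    arcSize-≤ a = ≤-trans (length-deduplicate (HyTN._≟_ (ℋ ε)) (arcNodes a))
      (s≤s (≤-reflexive (length-map proj₁ (toList (Hyperarc.heads a)))))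

    scenario-≤ : ∀ {A} s (a : Hyperarc (V⁺ s)) → RestrictionOf Γ A a →
                 arcSize (mapArc (node s) (node-injective s) a) ≤ length (toList (HyperConstraint.heads A)) + 1
    scenario-≤ {A} s a (heads≤ , _) = begin
      arcSize a′                                         ≤⟨ arcSize-≤ a′ ⟩
      suc (length (toList (Hyperarc.heads a′)))
        ≡⟨ cong suc (length-map _ (toList (Hyperarc.heads a))) ⟩
      suc (length (toList (Hyperarc.heads a)))           ≤⟨ s≤s heads≤ ⟩
      suc (length (toList (HyperConstraint.heads A)))    ≡⟨ +-comm _ 1 ⟨
      length (toList (HyperConstraint.heads A)) + 1      ∎
      where a′ = mapArc (node s) (node-injective s) a

    -- The tail, the copy of `u` under `s₂` and at most `∣P∣` observations; `1 ≤ ∣P∣` absorbs the 2,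
    -- which is where the constant 3 comes from.
    α-≤ : ∀ s₁ s₂ u t₁ t₂ → arcSize (α ε s₁ s₂ u t₁ t₂) ≤ 3 * ∣P∣
    α-≤ s₁ s₂ u t₁ t₂ = begin
      arcSize (α ε s₁ s₂ u t₁ t₂)         ≤⟨ arcSize-≤ (α ε s₁ s₂ u t₁ t₂) ⟩
      2 + length (map _ (Δ s₁ s₂))        ≡⟨ cong (λ k → 2 + k) (length-map _ (Δ s₁ s₂)) ⟩
      2 + length (Δ s₁ s₂)                ≤⟨ +-mono-≤ (*-monoʳ-≤ 2 1≤P) (Δ-length s₁ s₂) ⟩
      2 * ∣P∣ + ∣P∣                       ≡⟨ +-comm (2 * ∣P∣) ∣P∣ ⟩
      3 * ∣P∣                             ∎

-- From schedules to strategies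

-- Left transparent, instances of Satisfies are compared by unfolding them down
-- to the Cauchy proofs of the minima.
opaque
  Sat : ∀ {X : Set} → Schedule X → Hyperarc X → Set
  Sat = Satisfies

  wrap : ∀ {X : Set} {φ : Schedule X} {a} → Satisfies φ a → Sat φ a
  wrap sat = sat

  unwrap : ∀ {X : Set} {φ : Schedule X} {a} → Sat φ a → Satisfies φ a
  unwrap sat = sat

module _ {X : Set} (φ : Schedule X) (a : Hyperarc X) where
  open Hyperarc a

  Within : X × ℝ → Set
  Within (v , w) = φ v -ℝ w ≤ℝ φ tail

  sat⁺ : Any Within (toList heads) → Sat φ a
  sat⁺ any = wrap (minℝ-≤ {φ tail} _ _ (Any.map⁺ any))

  sat⇒¬¬any : Sat φ a → ¬ All (¬_ ∘ Within) (toList heads)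
  sat⇒¬¬any sat none = minℝ-attained {φ tail} _ _ (unwrap sat) (All.map⁺ none)

  -- Used for the arcs `α`, whose first head is the copy of the event under the other scenario and
  -- whose remaining heads are observations.
  sat⇒head : Sat φ a → All (λ (v , w) → φ tail <ℝ φ v -ℝ w) (List⁺.tail heads) →
             Within (List⁺.head heads)
  sat⇒head sat later = minℝ≤⇒head≤ {φ tail} _ _ (unwrap sat) (All.map⁺ later)

-- Stated for abstract operations for the same reason.
module _ {R : Set} (min : List⁺ R → R) (_-_ : R → ℝ → R) (_≼_ : R → R → Set) where

  mapArc-generic : ∀ {A B : Set} (φ : B → R) (f : A → B) (f-inj : Injective _≡_ _≡_ f) a →
    (min (map⁺ (λ (v , w) → φ v - w) (Hyperarc.heads (mapArc f f-inj a))) ≼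
      φ (Hyperarc.tail (mapArc f f-inj a))) ≡
    (min (map⁺ (λ (v , w) → (φ ∘ f) v - w) (Hyperarc.heads a)) ≼ (φ ∘ f) (Hyperarc.tail a))
  mapArc-generic φ f f-inj a = cong (λ xs → min xs ≼ φ (f (Hyperarc.tail a)))
    (sym (List⁺.map-∘ (Hyperarc.heads a)))

module _ {A B : Set} (φ : Schedule B) (f : A → B) (f-inj : Injective _≡_ _≡_ f) (a : Hyperarc A) where

  sat-mapArc⁻ : Sat φ (mapArc f f-inj a) → Sat (φ ∘ f) a
  sat-mapArc⁻ sat = wrap (subst (λ S → S) (mapArc-generic minℝ _-ℝ_ _≤ℝ_ φ f f-inj a) (unwrap sat))

  sat-mapArc⁺ : Sat (φ ∘ f) a → Sat φ (mapArc f f-inj a)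
  sat-mapArc⁺ sat = wrap (subst (λ S → S) (sym (mapArc-generic minℝ _-ℝ_ _≤ℝ_ φ f f-inj a)) (unwrap sat))

T-does : ∀ {A : Set} (A? : Dec A) → T (does A?) → A
T-does (yes a) _ = a

does-T : ∀ {A : Set} (A? : Dec A) → A → T (does A?)
does-T (yes _) _ = _
does-T (no ¬a) a = ¬a a

agree⇒⟦⟧ : ∀ {m} (ℓ : Label m) s₁ s₂ → (∀ p → p occursIn ℓ → lookup s₁ p ≡ lookup s₂ p) →
           T (s₁ ⟦ ℓ ⟧) → T (s₂ ⟦ ℓ ⟧)
agree⇒⟦⟧ ℓ s₁ s₂ agree t = Equivalence.from T-∧
  ( does-T (pos ⊆? s₂) (λ i → transfer (agree _ (p⊆p∪q neg i)) (T-does (pos ⊆? s₁) pos⊆ i))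
  , does-T (neg ⊆? ∁ s₂) (λ i → x∉p⇒x∈∁p (x∈∁p⇒x∉p (T-does (neg ⊆? ∁ s₁) neg⊆ i)
                                     ∘ transfer (sym (agree _ (q⊆p∪q pos neg i))))))
  where
  pos = Label.positive ℓ
  neg = Label.negative ℓ
  pos⊆ = proj₁ (Equivalence.to (T-∧ {does (pos ⊆? s₁)}) t)
  neg⊆ = proj₂ (Equivalence.to (T-∧ {does (pos ⊆? s₁)}) t)
  transfer : ∀ {p s s′} → lookup s p ≡ lookup s′ p → p ∈ₛ s → p ∈ₛ s′
  transfer eq i = Vec.lookup⇒[]= _ _ (trans (sym eq) (Vec.[]=⇒lookup i))

module Arcs (Γ : CHyTN) where
  open CHyTN Γ

  Δ-∈ : ∀ {s₁ s₂ p} t → lookup s₁ p ≢ lookup s₂ p → (obs p , t) ∈ Δ s₁ s₂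
  Δ-∈ {s₁} {s₂} {p} t d = retain-∈ _ t (∈-map⁺ obs (∈-filter⁺ _ (∈-allFin p) d))

  Δ-all : ∀ {s₁ s₂} {P : Pred (V⁺ s₁) 0ℓ} →
          (∀ p t → lookup s₁ p ≢ lookup s₂ p → P (obs p , t)) → All P (Δ s₁ s₂)
  Δ-all {s₁} {s₂} P-obs = All.map (λ { {_ , t} (p , refl , d) → P-obs p t d })
    (retain-All (λ v → s₁ ⟦ L v ⟧) {P = λ v → ∃ λ p → v ≡ obs p × lookup s₁ p ≢ lookup s₂ p}
      (All.map⁺ (All.map (λ {p} d → p , refl , d) (All.all-filter _ (allFin ∣P∣)))))

  arcs⁺ : ∀ {ε} {P : Pred (Hyperarc Node) 0ℓ} →
    (∀ s {a} → a ∈ 𝒜⁺ s → P (mapArc (node s) (node-injective s) a)) →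
    (∀ s₁ s₂ u t₁ t₂ → P (α ε s₁ s₂ u t₁ t₂)) → All P (HyTN.arcs (ℋ ε))
  arcs⁺ scenario dynamic = All.++⁺
    (All.concat⁺ (All.map⁺ (All.universal (λ s → All.map⁺ (All.tabulate (scenario s))) Σ-P)))
    (All.concat⁺ (All.map⁺ (All.universal
      (λ (s₁ , s₂) → All.map⁺ (All.universal (λ (u , _) → dynamic s₁ s₂ u _ _) _))
      (cartesianProduct Σ-P Σ-P))))

  scenarioArcs⁻ : ∀ {ε} {P : Pred (Hyperarc Node) 0ℓ} → All P (HyTN.arcs (ℋ ε)) →
    ∀ s → All (P ∘ mapArc (node s) (node-injective s)) (𝒜⁺ s)
  scenarioArcs⁻ ps s = All.map⁻ (All.lookup
    (All.map⁻ (All.concat⁻ {xss = map _ Σ-P} (All.++⁻ˡ scenarioArcs ps))) (scenarios-complete ∣P∣ s))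

  dynamicArcs⁻ : ∀ {ε} {P : Pred (Hyperarc Node) 0ℓ} → All P (HyTN.arcs (ℋ ε)) →
    ∀ s₁ s₂ u t₁ t₂ → P (α ε s₁ s₂ u t₁ t₂)
  dynamicArcs⁻ {ε} {P} ps s₁ s₂ u t₁ t₂ = subst₂ (λ t₁ t₂ → P (α ε s₁ s₂ u t₁ t₂))
    (T-irrelevant _ t₁) (T-irrelevant _ t₂)
    (All.lookup (All.map⁻ (All.lookup
      (All.map⁻ (All.concat⁻ {xss = map _ (cartesianProduct Σ-P Σ-P)} (All.++⁻ʳ scenarioArcs ps)))
      (∈-cartesianProduct⁺ (scenarios-complete ∣P∣ s₁) (scenarios-complete ∣P∣ s₂))))
      (retain-∈ _ (Equivalence.from T-∧ (t₁ , t₂)) (∈-allFin u)))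

module FromSchedule (Γ : CHyTN) (ε : ℝ) (0<ε : 0ℝ <ℝ ε) (φ : Schedule (CHyTN.Node Γ))
  (sat : All (Sat φ) (HyTN.arcs (CHyTN.ℋ Γ ε))) where
  open CHyTN Γ
  open Arcs Γ

  σ : Strategy
  σ s v = φ (node s v)

  sat-σ : ∀ s → All (Sat (σ s)) (𝒜⁺ s)
  sat-σ s = All.map (λ {a} → sat-mapArc⁻ φ (node s) (node-injective s) a) (scenarioArcs⁻ {ε} sat s)

  viable : Viable σ
  viable s = All.map unwrap (sat-σ s)

  -- A distinguishing observation not before `u` misses its bound by at least `ε > 0`, so the arc
  -- can only be met through the copy of `u` under `s₂`.
  α-≤ : ∀ s₁ s₂ u t₁ t₂ →
    (∀ p t → lookup s₁ p ≢ lookup s₂ p → σ s₁ (u , t₁) ≤ℝ σ s₁ (obs p , t)) →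
    σ s₂ (u , t₂) ≤ℝ σ s₁ (u , t₁)
  α-≤ s₁ s₂ u t₁ t₂ later = ≤ℝ-trans {u₂} {u₂ -ℝ 0ℝ} {u₁} (x≤x-0 u₂)
    (sat⇒head φ (α ε s₁ s₂ u t₁ t₂) (dynamicArcs⁻ {ε} sat s₁ s₂ u t₁ t₂)
      (All.map⁺ (Δ-all {s₁} {s₂} λ p t d → ≤ℝ-<ℝ-trans {u₁} {σ s₁ (obs p , t)} {σ s₁ (obs p , t) -ℝ (-ℝ ε)}
        (later p t d) (x<x+pos (σ s₁ (obs p , t)) {ε} 0<ε))))
    where u₁ = σ s₁ (u , t₁)
          u₂ = σ s₂ (u , t₂)

  -- The constraint from `WD2`, restricted to `s`, puts the observation at least `ε₀ > 0` before
  -- `u`. The restriction carries its own proofs of membership in `V⁺ s`, which are exchanged by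
  -- irrelevance.
  observed-before : ∀ s {u p} (occ : p occursIn L u) t tₚ → σ s (obs p , tₚ) <ℝ σ s (u , t)
  observed-before s {u} {p} occ t tₚ
    with _ , ε₀ , 0<ε₀ , A∈ ← WD2 u p occ
    with a , eq , t′ , tₚ′ , tail≡ , heads≡ ← restrict-standard Γ s A∈ t =
    subst₂ (λ t t′ → σ s (obs p , t) <ℝ σ s (u , t′)) (T-irrelevant tₚ′ tₚ) (T-irrelevant t′ t)
      (<ℝ-≤ℝ-trans {o} {o -ℝ fromℤ (ℤ.- ε₀)} {σ s (u , t′)} (x<x-neg o (ℤ.neg-mono-< 0<ε₀)) o-≤)
    where
    o = σ s (obs p , tₚ′)
    o-≤ : o -ℝ fromℤ (ℤ.- ε₀) ≤ℝ σ s (u , t′)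
    o-≤ = subst₂ (λ hs v → minℝ (map⁺ (λ (v , w) → σ s v -ℝ w) hs) ≤ℝ σ s v) heads≡ tail≡
      (unwrap (All.lookup (sat-σ s) (∈-catMaybes-mapWith∈ (restrict s) A∈ eq)))

  module _ {s₁ s₂ v} (t₁ : T (s₁ ⟦ L v ⟧)) (t₂ : T (s₂ ⟦ L v ⟧)) (con : Con (scHst s₁ (v , t₁) σ) s₂) where

    v₁ v₂ : ℝ
    v₁ = σ s₁ (v , t₁)
    v₂ = σ s₂ (v , t₂)

    -- An earliest observation cannot be selected, as real times are not decidably ordered. A strict
    -- order on the finite type `Fin ∣P∣` is still well-founded, so induction replaces the
    -- selection.
    _⊏_ : Fin ∣P∣ → Fin ∣P∣ → Set
    p ⊏ q = ∃ λ t → ∃ λ t′ → σ s₂ (obs p , t) <ℝ σ s₂ (obs q , t′)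

    ⊏-isStrictPartialOrder : IsStrictPartialOrder _≡_ _⊏_
    ⊏-isStrictPartialOrder = record
      { isEquivalence = isEquivalence
      ; irrefl = λ { {p} refl (t , t′ , lt) → <ℝ-irrefl {σ s₂ (obs p , t)}
          (subst (λ t′ → σ s₂ (obs p , t) <ℝ σ s₂ (obs p , t′)) (T-irrelevant t′ t) lt) }
      ; trans = λ { {p} {q} {r} (t , t′ , lt) (t″ , t‴ , lt′) → t , t‴ ,
          ≤ℝ-<ℝ-trans {σ s₂ (obs p , t)} {σ s₂ (obs q , t′)} {σ s₂ (obs r , t‴)}
            (<ℝ⇒≤ℝ {σ s₂ (obs p , t)} {σ s₂ (obs q , t′)} lt)
            (subst (λ t → σ s₂ (obs q , t) <ℝ σ s₂ (obs r , t‴)) (T-irrelevant t″ t′) lt′) }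
      ; <-resp-≈ = (λ { refl lt → lt }) , (λ { refl lt → lt })
      }

    -- By induction on the time of observation under s₂: an earliest
    -- observation before v₂ distinguishing the scenarios would also be made
    -- under s₁, no later, hence before v₁.
    no-early-difference : v₂ <ℝ v₁ → ∀ p → Acc _⊏_ p → ∀ t → lookup s₂ p ≢ lookup s₁ p →
                          ¬ σ s₂ (obs p , t) <ℝ v₂
    no-early-difference v₂<v₁ p (acc ih) t s₂≢s₁ o₂<v₂ =
      s₂≢s₁ (con p (lookup s₁ p) (refl , tₒ ,
        ≤ℝ-<ℝ-trans {σ s₁ (obs p , tₒ)} {o₂} {v₁} o₁≤o₂
          (≤ℝ-<ℝ-trans {o₂} {v₂} {v₁} (<ℝ⇒≤ℝ {o₂} {v₂} o₂<v₂) v₂<v₁)))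
      where
      o₂ = σ s₂ (obs p , t)

      not-before : ∀ q t′ → lookup s₂ q ≢ lookup s₁ q → ¬ σ s₂ (obs q , t′) <ℝ o₂
      not-before q t′ d q<p = no-early-difference v₂<v₁ q (ih (t′ , t , q<p)) t′ d
        (≤ℝ-<ℝ-trans {σ s₂ (obs q , t′)} {o₂} {v₂} (<ℝ⇒≤ℝ {σ s₂ (obs q , t′)} {o₂} q<p) o₂<v₂)

      -- By `WD2` each variable in the label of `obs p` is observed strictly before it under `s₂`,
      -- so the induction hypothesis rules out a difference. The label thus stays true under `s₁`.
      agree : ∀ q → q occursIn L (obs p) → lookup s₂ q ≡ lookup s₁ q
      agree q occ = decidable-stable (lookup s₂ q Bool.≟ lookup s₁ q) λ d →
        let t′ = proj₁ (WD2 (obs p) q occ) s₂ t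
        in not-before q t′ d (observed-before s₂ occ t t′)

      tₒ : T (s₁ ⟦ L (obs p) ⟧)
      tₒ = agree⇒⟦⟧ (L (obs p)) s₂ s₁ agree t

      o₁≤o₂ : σ s₁ (obs p , tₒ) ≤ℝ o₂
      o₁≤o₂ = α-≤ s₂ s₁ (obs p) t tₒ λ q t′ d → ≮ℝ⇒≥ℝ {σ s₂ (obs q , t′)} {o₂} (not-before q t′ d)

    v₂≤v₁ : v₂ ≤ℝ v₁
    v₂≤v₁ = α-≤ s₁ s₂ v t₁ t₂ λ p t s₁≢s₂ → ≮ℝ⇒≥ℝ {σ s₁ (obs p , t)} {v₁} λ o₁<v₁ →
      s₁≢s₂ (sym (con p (lookup s₁ p) (refl , t , o₁<v₁)))

    -- Not symmetric to `v₂≤v₁`, since `con` speaks only of the history under `s₁`. Assuming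
    -- `v₂ <ℝ v₁` is what places early distinguishing observations of `s₂` in that history.
    v₁≤v₂ : v₁ ≤ℝ v₂
    v₁≤v₂ = ≮ℝ⇒≥ℝ {v₂} {v₁} λ v₂<v₁ → <ℝ⇒≱ℝ {v₂} {v₁} v₂<v₁
      (α-≤ s₂ s₁ v t₂ t₁ λ p t d → ≮ℝ⇒≥ℝ {σ s₂ (obs p , t)} {v₂}
        (no-early-difference v₂<v₁ p (spo-wellFounded ⊏-isStrictPartialOrder p) t d))

  dynamic : Dynamic σ
  dynamic s₁ s₂ v t₁ t₂ con = ≤ℝ-antisym {σ s₁ (v , t₁)} {σ s₂ (v , t₂)} (v₁≤v₂ t₁ t₂ con) (v₂≤v₁ t₁ t₂ con)

-- From strategies to schedules

length≡suc-pred : ∀ {A : Set} {x : A} {xs} → x ∈ xs → length xs ≡ suc (ℕ.pred (length xs))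
length≡suc-pred (here _)  = refl
length≡suc-pred (there _) = refl

module _ {A B : Set} {R : REL A B 0ℓ} where

  all∃⇒pointwise : ∀ {xs} → All (λ x → ∃ (R x)) xs → ∃ (Pointwise R xs)
  all∃⇒pointwise []             = [] , []
  all∃⇒pointwise ((y , r) ∷ ps) with ys , rs ← all∃⇒pointwise ps = y ∷ ys , r ∷ rs

  module _ {P : Pred A 0ℓ} {Q : Pred B 0ℓ} where

    pointwise-any⁻ : (∀ {x y} → R x y → Q y → P x) →
                     ∀ {xs ys} → Pointwise R xs ys → Any Q ys → Any P xs
    pointwise-any⁻ f (r ∷ _)  (here q)  = here (f r q)
    pointwise-any⁻ f (_ ∷ rs) (there i) = there (pointwise-any⁻ f rs i)

    pointwise-none : (∀ {x y} → R x y → P x → Q y) →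
                     ∀ {xs ys} → Pointwise R xs ys → ¬ Any Q ys → All (¬_ ∘ P) xs
    pointwise-none f []       none = []
    pointwise-none f (r ∷ rs) none = none ∘ here ∘ f r ∷ pointwise-none f rs (none ∘ there)

-- Two separate implications, because the search may return a solution that is not a rounding:
-- `complete` shows that roundings solve the integer arc, `sound` leads back from any solution.
record IntForm {X : Set} (Sound Rounds : (X → ℕ) → Set) (t : X) : Set where
  field
    intHeads : List (X × ℤ)
    sound    : ∀ ψ → IntSatisfies ψ (t , intHeads) → Sound ψ
    complete : ∀ ψ → Rounds ψ → IntSatisfies ψ (t , intHeads)
open IntForm

-- The number of nodes must have the form `suc m` to serve as a denominator. The equation is
-- required only in the presence of a node, as it fails for an empty network. The nodes do not
-- depend on `ε`, so `ℋ 0ℝ` can be used to count them before `ε₁` is chosen.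
module FromStrategy (Γ : CHyTN) (m : ℕ)
  (m-nodes : ∀ (v : CHyTN.Node Γ) → length (HyTN.nodes (CHyTN.ℋ Γ 0ℝ)) ≡ suc m) where
  open CHyTN Γ

  ∈-nodes : ∀ v → v ∈ HyTN.nodes (ℋ 0ℝ)
  ∈-nodes = HyTN.complete (ℋ 0ℝ)

  ε₁ : ℝ
  ε₁ = fromℚ (1ℤ / suc m)

  0<ε₁ : 0ℝ <ℝ ε₁
  0<ε₁ = 1ℤ / suc m , 0<1/m , 0 , λ _ _ → ℚ.≤-reflexive (ℚ.+-identityˡ _)
    where
    0<1/m : 0ℚ ℚ.< 1ℤ / suc m
    0<1/m = subst (ℚ._< 1ℤ / suc m) (/-zero m) (/-mono-< m {0ℤ} {1ℤ} (ℤ.+<+ (ℕ.s≤s ℕ.z≤n)))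

  module _ (σ : Strategy) (viable : Viable σ) (dynamic : Dynamic σ) where
    open Arcs Γ

    φ : Schedule Node
    φ ((v , s) , t) = σ s (v , t)

    _≤φ_+_ : Node → Node → ℤ → Set
    a ≤φ b + z = φ a -ℝ fromℤ z ≤ℝ φ b

    open Rounding ∈-nodes _≤φ_+_
      (λ a → x-0≤x (φ a))
      (λ {a} {b} {c} {w} {z} → -fromℤ-trans {φ a} {φ b} {φ c} w z)
      (λ {a} {b} {w} {z} → -fromℤ-mono {φ a} {φ b} {w} {z})
      (λ {a} {z} → -fromℤ-nonneg {φ a} {z})
      (λ a b → -fromℤ-arch (φ a) (φ b))

    IsRounding′ : (Node → ℕ) → Set
    IsRounding′ = IsRounding _≤φ_+_ (length (HyTN.nodes (ℋ 0ℝ)))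

    scaled : (Node → ℕ) → Schedule Node
    scaled ψ v = fromℚ (+ ψ v / suc m)

    Discretization : Hyperarc Node → Set
    Discretization a = IntForm (λ ψ → Sat (scaled ψ) a) IsRounding′ (Hyperarc.tail a)

    Scales : Node × ℝ → Node × ℤ → Set
    Scales (v , w) (v′ , k) = v ≡ v′ × ∀ n → seq w n ≡ k / suc m

    scales-sound : ∀ a {hs} → Pointwise Scales (toList (Hyperarc.heads a)) hs →
                   ∀ ψ → IntSatisfies ψ (Hyperarc.tail a , hs) → Sat (scaled ψ) a
    scales-sound a scales ψ any = sat⁺ (scaled ψ) a (pointwise-any⁻
      (λ { {_ , w} {v , k} (refl , w≡k) ψv≤ →
        scaled-≤ m {+ ψ v} {+ ψ (Hyperarc.tail a)} {k} w w≡k ψv≤ }) scales any)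

    integral-discretization : ∀ a → Sat φ a →
      All (λ (_ , w) → ∃ λ z → ∀ n → seq w n ≡ z / 1) (toList (Hyperarc.heads a)) → Discretization a
    integral-discretization a sat integral = record
      { intHeads = proj₁ chosen
      ; sound    = scales-sound a (Pointwise.map (λ { {_ , w} (v≡ , z , w≡z , refl) →
                     v≡ , λ n → trans (w≡z n) (/-scale m z) }) (proj₂ chosen))
      -- Which head meets the real constraint is known only up to double negation; decidability of
      -- the integer constraint makes that enough.
      ; complete = λ ψ rounding → decidable-stable (intSatisfies? ψ (tail , proj₁ chosen)) λ none →
          sat⇒¬¬any φ a sat (pointwise-none (λ {x} {y} → kept ψ rounding {x} {y}) (proj₂ chosen) none)
      }
      where
      open Hyperarc a

      Rounds : Node × ℝ → Node × ℤ → Set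
      Rounds (v , w) (v′ , k) = v ≡ v′ × ∃ λ z → (∀ n → seq w n ≡ z / 1) × k ≡ z ℤ.* + suc m

      chosen : ∃ (Pointwise Rounds (toList heads))
      chosen = all∃⇒pointwise (All.map (λ { {v , _} (z , w≡z) → (v , z ℤ.* + suc m) , refl , z , w≡z , refl }) integral)

      kept : ∀ ψ → IsRounding′ ψ → ∀ {x y} → Rounds x y → Within φ a x →
             + ψ (proj₁ y) ℤ.≤ + ψ tail ℤ.+ proj₂ y
      kept ψ rounding {v , w} {_ , _} (refl , z , w≡z , refl) within =
        subst (λ n → + ψ v ℤ.≤ + ψ tail ℤ.+ z ℤ.* + n) (m-nodes v)
          (IsRounding.diff rounding {v} {tail} {z}
            (≤ℝ-trans {φ v -ℝ fromℤ z} {φ v -ℝ w} {φ tail}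
              (≤ℝ-pointwise {φ v -ℝ fromℤ z} {φ v -ℝ w} λ n →
                ℚ.≤-reflexive (cong (λ q → seq (φ v) n ℚ.- q) (sym (w≡z n))))
              within))

    scenario-discretization : ∀ s {a} → a ∈ 𝒜⁺ s → Discretization (mapArc (node s) (node-injective s) a)
    scenario-discretization s {a} a∈ = integral-discretization (mapArc (node s) (node-injective s) a)
      (sat-mapArc⁺ φ (node s) (node-injective s) a (wrap {φ = σ s} (All.lookup (viable s) a∈)))
      (All.map⁺ (All.lookup integral a∈))
      where
      integral : All (λ a → All (λ (_ , w) → ∃ λ z → ∀ n → seq w n ≡ z / 1) (toList (Hyperarc.heads a))) (𝒜⁺ s)
      integral = all-catMaybes-mapWith∈ 𝒜 λ A∈ → Maybe.map proj₂ (restrict-restrictionOf Γ s A∈)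

    -- Multiplied by `suc m`, the weights `0` and `-ε₁` become `0` and `-1`. If no observation head
    -- is met, no distinguishing observation precedes `u` under `s₁`, for strictness would put its
    -- rounded time at least 1 earlier. Then `dynamic` equates the two times of `u`, and the first
    -- head is met.
    α-discretization : ∀ s₁ s₂ u t₁ t₂ → Discretization (α ε₁ s₁ s₂ u t₁ t₂)
    α-discretization s₁ s₂ u t₁ t₂ = record
      { intHeads = hs
      ; sound    = scales-sound (α ε₁ s₁ s₂ u t₁ t₂)
          ((refl , λ _ → sym (/-zero m)) ∷ Pointwise.map⁺ _ _ (Pointwise.refl (refl , λ _ → /-neg m 1ℤ)))
      ; complete = λ ψ rounding → decidable-stable (intSatisfies? ψ (u₁ , hs)) λ none → none (here (same ψ rounding none))
      }
      where
      u₁ u₂ : Node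
      u₁ = node s₁ (u , t₁)
      u₂ = node s₂ (u , t₂)

      hs : List (Node × ℤ)
      hs = (u₂ , 0ℤ) ∷ map (λ v → node s₁ v , -1ℤ) (Δ s₁ s₂)

      module _ ψ (rounding : IsRounding′ ψ) (none : ¬ IntSatisfies ψ (u₁ , hs)) where

        con : Con (scHst s₁ (u , t₁) σ) s₂
        con p _ (refl , t , o<u) = decidable-stable (lookup s₂ p Bool.≟ lookup s₁ p) λ differ →
          none (there (Any.map⁺ (lose (Δ-∈ {s₁} {s₂} t (differ ∘ sym))
            (subst (+ ψ o ℤ.≤_) (ℤ.+-comm -1ℤ (+ ψ u₁)) (ℤ.i<j⇒i≤pred[j] (IsRounding.strict rounding {o} {u₁}
              (≤ℝ-trans {φ o -ℝ 0ℝ} {φ o} {φ u₁} (x-0≤x (φ o)) (<ℝ⇒≤ℝ {φ o} {φ u₁} o<u))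
              λ u≤o → <ℝ⇒≱ℝ {φ o} {φ u₁} o<u (≤ℝ-trans {φ u₁} {φ u₁ -ℝ 0ℝ} {φ o} (x≤x-0 (φ u₁)) u≤o)))))))
          where o = node s₁ (obs p , t)

        same : + ψ u₂ ℤ.≤ + ψ u₁ ℤ.+ 0ℤ
        same = IsRounding.diff rounding {u₂} {u₁} {0ℤ}
          (≤ℝ-trans {φ u₂ -ℝ 0ℝ} {φ u₂} {φ u₁} (x-0≤x (φ u₂))
            (≃ℝ⇒≥ℝ {φ u₁} {φ u₂} (dynamic s₁ s₂ u t₁ t₂ con)))

    discretizations : All Discretization (HyTN.arcs (ℋ ε₁))
    discretizations = arcs⁺ {ε₁} scenario-discretization α-discretization

    intArcs : ∀ {as} → All Discretization as → List IntArc
    intArcs = All.reduce λ {a} d → Hyperarc.tail a , intHeads d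

    all-complete : ∀ {as} (ds : All Discretization as) → ∀ {ψ} → IsRounding′ ψ → All (IntSatisfies ψ) (intArcs ds)
    all-complete []       rounding = []
    all-complete (d ∷ ds) rounding = complete d _ rounding ∷ all-complete ds rounding

    all-sound : ∀ {as} (ds : All Discretization as) → ∀ {ψ} → All (IntSatisfies ψ) (intArcs ds) → All (Sat (scaled ψ)) as
    all-sound []       []           = []
    all-sound (d ∷ ds) (sat ∷ sats) = sound d _ sat ∷ all-sound ds sats

    consistent : ∃ λ χ → All (Sat χ) (HyTN.arcs (ℋ ε₁))
    consistent =
      let ψ , sat = intConsistent-stable ∈-nodes (intArcs discretizations)
                      (¬¬-map (λ (ψ , r) → ψ , all-complete discretizations r) rounding)
      in scaled ψ , all-sound discretizations sat

theorem11 : ((Γ : CHyTN) → let open CHyTN Γ in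
    ∃ λ (ε : ℝ) → (0ℝ <ℝ ε) × (DynamicallyConsistent ⇔ Consistent (ℋ ε)))
    ×
    ((Γ : CHyTN) (ε : ℝ) → let open CHyTN Γ in
    HyTN.nodeCount (ℋ ε) ≤ ∣Σ-P∣ * ∣V∣)
    ×
    (∃ λ (C : ℕ) → (Γ : CHyTN) (ε : ℝ) → let open CHyTN Γ in
    HyTN.arcCount (ℋ ε) ≤ C * (∣Σ-P∣ * ∣𝒜∣ + ∣Σ-P∣ ^ 2 * ∣V∣))
    ×
    (∃ λ (C : ℕ) → (Γ : CHyTN) (ε : ℝ) → let open CHyTN Γ in
    1 ≤ ∣P∣ →
    HyTN.size (ℋ ε) ≤ C * (∣Σ-P∣ * m𝒜 + ∣Σ-P∣ ^ 2 * ∣V∣ * ∣P∣))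
theorem11 = equivalence , Counting.nodeCount-≤ , (1 , Counting.arcCount-≤) , (3 , Counting.size-≤)
  where
  equivalence : (Γ : CHyTN) → let open CHyTN Γ in
    ∃ λ (ε : ℝ) → (0ℝ <ℝ ε) × (DynamicallyConsistent ⇔ Consistent (ℋ ε))
  equivalence Γ = ε₁ , 0<ε₁ , mk⇔
    (λ (σ , viable , dynamic) → let χ , sat = consistent σ viable dynamic in χ , All.map unwrap sat)
    (λ (φ , sat) → let open FromSchedule Γ ε₁ 0<ε₁ φ (All.map wrap sat) in σ , viable , dynamic)
    where
    open CHyTN Γ
    open FromStrategy Γ (ℕ.pred (length (HyTN.nodes (ℋ 0ℝ))))
      (λ v → length≡suc-pred (HyTN.complete (ℋ 0ℝ) v))
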